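{- Let $G_1,G_2$ be finite groups. The following are equivalent: (i) the power graphs $\mathcal P_{G_1}$ and $\mathcal P_{G_2}$ are isomorphic; (ii) the power digraphs $\overrightarrow{\mathcal P}_{G_1}$ and $\overrightarrow{\mathcal P}_{G_2}$ are isomorphic; (iii) the digraphs $\mathcal O_{G_1}$ and $\mathcal O_{G_2}$ are isomorphic; (iv) the posets $L_{G_1}$ and $L_{G_2}$ are isomorphic; (v) there is an isomorphism $\tau$ from the poset $L_{G_1}/\mathcal C'(G_1)$ to the poset $L_{G_2}/\mathcal C'(G_2)$ such that $|\tau(S)|=|S|$ for each $S\in\mathcal C'(G_1)$.
   Context: For a finite group $G$: the power graph $\mathcal P_G$ has vertex set $G$, two distinct elements adjacent iff one is a power of the other; the power digraph $\overrightarrow{\mathcal P}_G$ has vertex set $G$ and an arc $x\to y$ iff $x\ne y$ and $y=x^m$ for some positive integer $m$. For $x\in G$, $[x]$ is the set of generators of $\langle x\rangle$, and $\mathcal C'(G)=\{[x]: x\in G\}$ (a partition of $G$). Fix for each member of $\mathcal C'(G)$ an arbitrary linear ordering. Define $x\prec y$ if either $x,y$ lie in the same member of $\mathcal C'(G)$ with $x$ preceding $y$, or $\langle x\rangle\subsetneqq\langle y\rangle$; and $x\preceq y$ iff $x\prec y$ or $x=y$. Then $L_G=(G,\preceq)$ is a poset, and $\mathcal O_G$ is the digraph on $G$ with an arc $x\to y$ iff $y\prec x$. The quotient poset $L_G/\mathcal C'(G)$ has element set $\mathcal C'(G)$, with $S_1\le S_2$ iff $S_1=S_2$ or $x\prec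 y$ for all $x\in S_1$, $y\in S_2$. -}

module Defs where

open import Data.Nat using (ℕ; zero; suc)
open import Data.Fin using (Fin)
open import Data.Product using (Σ; ∃; _×_; _,_)
open import Data.Sum using (_⊎_)
open import Relation.Nullary using (¬_)
open import Relation.Binary.PropositionalEquality using (_≡_; _≢_)
open import Algebra.Structures using (IsGroup)
open import Function.Bundles using (_↔_; _⇔_; Inverse)

record FinGroup : Set where
  field
    n       : ℕ
    _∙_     : Fin n → Fin n → Fin n
    ε       : Fin n
    _⁻¹     : Fin n → Fin n
    isGroup : IsGroup _≡_ _∙_ ε _⁻¹

Elt : FinGroup → Set
Elt G = Fin (FinGroup.n G)

module _ (G : FinGroup) where
  open FinGroup G

  pow : Fin n → ℕ → Fin n
  pow x zero    = ε
  pow x (suc m) = x ∙ pow x m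

  InCyc : Fin n → Fin n → Set
  InCyc z x = ∃ λ m → z ≡ pow x m

  CycSub : Fin n → Fin n → Set
  CycSub x y = ∀ z → InCyc z x → InCyc z y

  CycSSub : Fin n → Fin n → Set
  CycSSub x y = CycSub x y × ¬ CycSub y x

  -- ⟨ x ⟩ = ⟨ y ⟩, i.e. x and y lie in the same member [x] = [y] of C'(G)
  SameCls : Fin n → Fin n → Set
  SameCls x y = CycSub x y × CycSub y x

  PArc : Fin n → Fin n → Set
  PArc x y = x ≢ y × ∃ λ m → y ≡ pow x (suc m)

  PAdj : Fin n → Fin n → Set
  PAdj x y = PArc x y ⊎ PArc y x

  -- A choice of a linear ordering on each member of C'(G):
  -- a relation whose restriction to every class is a strict linear order.
  -- (Only its values on pairs in the same class are ever used.)
  record ClassOrder : Set₁ where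
    field
      lt      : Fin n → Fin n → Set
      irrefl  : ∀ x → ¬ lt x x
      trans   : ∀ x y z → SameCls x y → SameCls y z → lt x y → lt y z → lt x z
      total   : ∀ x y → SameCls x y → x ≢ y → lt x y ⊎ lt y x

  module _ (o : ClassOrder) where
    open ClassOrder o

    Prec : Fin n → Fin n → Set
    Prec x y = (SameCls x y × lt x y) ⊎ CycSSub x y

    PrecEq : Fin n → Fin n → Set
    PrecEq x y = Prec x y ⊎ x ≡ y

    OArc : Fin n → Fin n → Set
    OArc x y = Prec y x

    -- order of the quotient poset L_G / C'(G), on representatives:
    -- [x] ≤ [y] iff [x] = [y] or a ≺ b for all a ∈ [x], b ∈ [y]
    QLe : Fin n → Fin n → Set
    QLe x y = SameCls x y ⊎ (∀ a b → SameCls a x → SameCls b y → Prec a b)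

RelIso : (G₁ G₂ : FinGroup) → (Elt G₁ → Elt G₁ → Set) → (Elt G₂ → Elt G₂ → Set) → Set
RelIso G₁ G₂ R₁ R₂ =
  Σ (Elt G₁ ↔ Elt G₂) λ f → ∀ x y → R₁ x y ⇔ R₂ (Inverse.to f x) (Inverse.to f y)

Equinum : {A B : Set} → (A → Set) → (B → Set) → Set
Equinum {A} {B} P Q =
  Σ (A → B) λ f → Σ (B → A) λ g →
    (∀ x → P x → Q (f x)) × (∀ y → Q y → P (g y)) ×
    (∀ x → P x → g (f x) ≡ x) × (∀ y → Q y → f (g y) ≡ y)

-- An isomorphism τ of quotient posets L_{G₁}/C'(G₁) → L_{G₂}/C'(G₂),
-- given on representatives, with |τ(S)| = |S| for each class S.
record QuotIso (G₁ G₂ : FinGroup) (o₁ : ClassOrder G₁) (o₂ : ClassOrder G₂) : Set where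
  field
    τ      : Elt G₁ → Elt G₂
    τ⁻     : Elt G₂ → Elt G₁
    τ-resp  : ∀ x y → SameCls G₁ x y → SameCls G₂ (τ x) (τ y)
    τ⁻-resp : ∀ x y → SameCls G₂ x y → SameCls G₁ (τ⁻ x) (τ⁻ y)
    invˡ   : ∀ x → SameCls G₁ (τ⁻ (τ x)) x
    invʳ   : ∀ y → SameCls G₂ (τ (τ⁻ y)) y
    order  : ∀ x y → QLe G₁ o₁ x y ⇔ QLe G₂ o₂ (τ x) (τ y)
    card   : ∀ x → Equinum (SameCls G₁ x) (SameCls G₂ (τ x))

{-# OPTIONS --safe #-}
-- Write y ⊑ x for y ∈ ⟨x⟩, and x ≈ y when x and y are comparable to the same elements and are
-- either both trivial or both non-trivial. If some y ≈ x lies strictly below x, then everything above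
-- y has order a power of a single prime, so a ≈-class is either the set of generators of one cyclic
-- group or a chain of such sets inside a cyclic p-group. For x ⊑ y in different ≈-classes this gives
-- |x/≈| ≤ |y/≈|.
--
-- A power graph isomorphism f, adjusted so that f ε = ε, preserves ≈. It cannot reverse y ⊑ x across
-- classes: up to replacing f by its inverse, an element z distinguishing x from y would satisfy
-- z, y ⊏ x with z, y incomparable, while f y and f z lie above f x, so the class sizes force
-- φ(ord x) ≤ φ(ord y) and φ(ord x) ≤ φ(ord z); equality of φ at a proper
-- divisor forces index 2, so ⟨y⟩ = ⟨z⟩. Hence f preserves the orders of the maximal elements of the
-- ≈-classes, and sending y to the element of order ord y below the maximal element of the class of
-- f y gives (v). Conversely, an isomorphism as in (v) lifts to a bijection by matching, within each
-- class, elements of equal rank, and this bijection respects all the structures in (ii)–(iv), each of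
-- which has the power graph as its comparability graph.
module Submission where

open import Defs
open import Algebra.Bundles using (Group)
import Algebra.Properties.Group as GroupProperties
open import Data.Empty using (⊥; ⊥-elim)
open import Data.Fin using (Fin; toℕ; fromℕ<)
import Data.Fin as Fin
open import Data.Fin.Permutation.Components using (transpose; transpose-inverse)
open import Data.Fin.Properties using (pigeonhole; any?; all?; toℕ<n; toℕ-fromℕ<; toℕ-injective; fromℕ<-injective) renaming (_≟_ to _≟ᶠ_)
open import Data.List using (List; []; _∷_; _++_; length; filter; allFin)
open import Data.List.Membership.Propositional using (_∈_)
open import Data.List.Membership.Propositional.Properties using (∈-∃++; ∈-++⁺ˡ; ∈-++⁺ʳ; ∈-++⁻; ∈-filter⁺; ∈-filter⁻; ∈-allFin)
open import Data.List.Properties using (length-++; filter-all; filter-none; length-tabulate)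
open import Data.List.Relation.Unary.All as All using (_∷_)
open import Data.List.Relation.Unary.AllPairs using (_∷_)
open import Data.List.Relation.Unary.Any using (here; there)
open import Data.List.Relation.Unary.Unique.Propositional using (Unique)
open import Data.List.Relation.Unary.Unique.Propositional.Properties using (filter⁺; allFin⁺)
open import Data.Nat
open import Data.Nat.Coprimality using (Coprime; coprime-divisor; coprime⇒gcd≡1)
open import Data.Nat.DivMod using (_%_; _/_; m%n<n; m≡m%n+[m/n]*n)
open import Data.Nat.Divisibility
open import Data.Nat.GCD using (gcd; gcd[m,n]∣m; gcd[m,n]∣n; module Bézout; gcd-GCD)
open import Data.Nat.Induction using (<-rec)
open import Data.Nat.Primality
open import Data.Nat.Primality.Factorisation using (factorise)
open import Data.Nat.Properties
open import Data.Product using (∃; _×_; _,_; proj₁; proj₂)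
open import Data.Sum using (_⊎_; inj₁; inj₂; [_,_])
open import Data.Unit using (⊤; tt)
open import Function.Base using (_∘_)
open import Function.Bundles using (_⇔_; mk⇔; _↔_; mk↔ₛ′; Inverse; Equivalence)
open import Relation.Binary.PropositionalEquality using (_≡_; _≢_; refl; sym; trans; cong; cong₂; subst; subst₂; module ≡-Reasoning)
open import Relation.Nullary using (¬_; Dec; yes; no; ¬?; _×-dec_; _⊎-dec_; _→-dec_)
open import Relation.Unary using (Decidable)

-- Counting

count : ∀ {n} {P : Fin n → Set} → Decidable P → ℕ
count P? = length (filter P? (allFin _))

-- Induction on `xs`: one occurrence of `f x` is cut out of `ys`, and injectivity sends the tail,
-- which does not contain `x`, into what remains.
injection-length : {A B : Set} (f : A → B) (xs : List A) (ys : List B) → Unique xs →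
  (∀ {x} → x ∈ xs → f x ∈ ys) → (∀ {x y} → x ∈ xs → y ∈ xs → f x ≡ f y → x ≡ y) →
  length xs ≤ length ys
injection-length f [] ys _ _ _ = z≤n
injection-length f (x ∷ xs) ys (x∉xs ∷ u) into inj with ∈-∃++ (into (here refl))
... | as , bs , refl = begin
  suc (length xs)               ≤⟨ s≤s (injection-length f xs (as ++ bs) u into′ λ p q → inj (there p) (there q)) ⟩
  suc (length (as ++ bs))       ≡⟨ cong suc (length-++ as) ⟩
  suc (length as + length bs)   ≡⟨ sym (+-suc (length as) (length bs)) ⟩
  length as + suc (length bs)   ≡⟨ sym (length-++ as) ⟩
  length (as ++ f x ∷ bs)       ∎
  where
  open ≤-Reasoning
  into′ : ∀ {z} → z ∈ xs → f z ∈ as ++ bs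
  into′ {z} z∈xs with ∈-++⁻ as (into (there z∈xs))
  ... | inj₁ p          = ∈-++⁺ˡ p
  ... | inj₂ (there p)  = ∈-++⁺ʳ as p
  ... | inj₂ (here fz≡fx) = ⊥-elim (All.lookup x∉xs z∈xs (inj (here refl) (there z∈xs) (sym fz≡fx)))

module _ {m n : ℕ} {P : Fin m → Set} {Q : Fin n → Set} (P? : Decidable P) (Q? : Decidable Q)
         (f : Fin m → Fin n) (into : ∀ x → P x → Q (f x))
         (inj : ∀ x y → P x → P y → f x ≡ f y → x ≡ y) where

  count-injection : count P? ≤ count Q?
  count-injection = injection-length f (filter P? (allFin m)) (filter Q? (allFin n)) (filter⁺ P? (allFin⁺ m))
    (λ p → ∈-filter⁺ Q? (∈-allFin _) (into _ (proj₂ (∈-filter⁻ P? {xs = allFin m} p))))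
    (λ p q → inj _ _ (proj₂ (∈-filter⁻ P? {xs = allFin m} p)) (proj₂ (∈-filter⁻ P? {xs = allFin m} q)))

  -- Cutting the missed element `z` out of the target list leaves room for all images in a list
  -- shorter by one.
  count-injection-< : ∀ z → Q z → (∀ x → P x → f x ≢ z) → count P? < count Q?
  count-injection-< z Qz miss with ∈-∃++ (∈-filter⁺ Q? (∈-allFin z) Qz)
  ... | as , bs , eq = begin
    suc (count P?)               ≤⟨ s≤s (injection-length f (filter P? (allFin m)) (as ++ bs) (filter⁺ P? (allFin⁺ m)) into′
                                      (λ p q → inj _ _ (proj₂ (∈-filter⁻ P? {xs = allFin m} p)) (proj₂ (∈-filter⁻ P? {xs = allFin m} q)))) ⟩
    suc (length (as ++ bs))      ≡⟨ cong suc (length-++ as) ⟩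
    suc (length as + length bs)  ≡⟨ sym (+-suc (length as) (length bs)) ⟩
    length as + suc (length bs)  ≡⟨ sym (length-++ as) ⟩
    length (as ++ z ∷ bs)        ≡⟨ cong length (sym eq) ⟩
    count Q?                     ∎
    where
    open ≤-Reasoning
    into′ : ∀ {x} → x ∈ filter P? (allFin m) → f x ∈ as ++ bs
    into′ {x} x∈ with ∈-++⁻ as (subst (f x ∈_) eq (∈-filter⁺ Q? (∈-allFin _) (into x (proj₂ (∈-filter⁻ P? {xs = allFin m} x∈)))))
    ... | inj₁ p         = ∈-++⁺ˡ p
    ... | inj₂ (there p) = ∈-++⁺ʳ as p
    ... | inj₂ (here e)  = ⊥-elim (miss x (proj₂ (∈-filter⁻ P? {xs = allFin m} x∈)) e)

module _ {n : ℕ} {P Q : Fin n → Set} (P? : Decidable P) (Q? : Decidable Q) where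

  count-mono : (∀ x → P x → Q x) → count P? ≤ count Q?
  count-mono P⊆Q = count-injection P? Q? (λ x → x) P⊆Q (λ _ _ _ _ e → e)

  count-mono-< : (∀ x → P x → Q x) → ∀ z → Q z → ¬ P z → count P? < count Q?
  count-mono-< P⊆Q z Qz ¬Pz =
    count-injection-< P? Q? (λ x → x) P⊆Q (λ _ _ _ _ e → e) z Qz (λ x Px e → ¬Pz (subst P e Px))

  private
    ∪∩ : (xs : List (Fin n)) →
      length (filter P? xs) + length (filter Q? xs) ≡
      length (filter (λ x → P? x ⊎-dec Q? x) xs) + length (filter (λ x → P? x ×-dec Q? x) xs)
    ∪∩ [] = refl
    ∪∩ (x ∷ xs) with P? x | Q? x
    ... | yes _ | yes _ = cong suc (trans (+-suc _ _) (trans (cong suc (∪∩ xs)) (sym (+-suc _ _))))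
    ... | yes _ | no _  = cong suc (∪∩ xs)
    ... | no _  | yes _ = trans (+-suc _ _) (cong suc (∪∩ xs))
    ... | no _  | no _  = ∪∩ xs

  count-∪∩ : count P? + count Q? ≡ count (λ x → P? x ⊎-dec Q? x) + count (λ x → P? x ×-dec Q? x)
  count-∪∩ = ∪∩ (allFin n)

count-pos : ∀ {n} {P : Fin n → Set} (P? : Decidable P) z → P z → 0 < count P?
count-pos P? z Pz = ≤-<-trans z≤n (count-mono-< {P = λ _ → ⊥} (λ _ → no λ ()) P? (λ _ ()) z Pz (λ ()))

count-⊤ : ∀ n → count {n} {λ _ → ⊤} (λ _ → yes tt) ≡ n
count-⊤ n = trans (cong length (filter-all (λ _ → yes tt) (All.universal (λ _ → tt) (allFin n)))) (length-tabulate {n = n} (λ i → i))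

count-none : ∀ {n} {P : Fin n → Set} (P? : Decidable P) → (∀ x → ¬ P x) → count P? ≡ 0
count-none {n} P? none = cong length (filter-none P? (All.universal none (allFin n)))

maximum : ∀ {n} {P : Fin n → Set} → Decidable P → (w : Fin n → ℕ) → ∀ x → P x →
  ∃ λ t → P t × (∀ u → P u → w u ≤ w t)
maximum {n} {P} P? w x Px with go (allFin n)
  where
  go : (us : List (Fin n)) → ∃ λ t → P t × (∀ u → u ∈ us → P u → w u ≤ w t)
  go []       = x , Px , λ _ ()
  go (v ∷ us) with go us | P? v
  ... | t , Pt , max | no ¬Pv = t , Pt , λ { u (here refl) Pu → ⊥-elim (¬Pv Pu) ; u (there p) Pu → max u p Pu }
  ... | t , Pt , max | yes Pv with ≤-total (w v) (w t)
  ...   | inj₁ v≤t = t , Pt , λ { u (here refl) _ → v≤t ; u (there p) Pu → max u p Pu }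
  ...   | inj₂ t≤v = v , Pv , λ { u (here refl) _ → ≤-refl ; u (there p) Pu → ≤-trans (max u p Pu) t≤v }
... | t , Pt , max = t , Pt , λ u Pu → max u (∈-allFin u) Pu

least : (P : ℕ → Set) → Decidable P → ∀ n → P n → ∃ λ m → P m × (∀ k → k < m → ¬ P k)
least P P? = <-rec (λ n → P n → ∃ λ m → P m × (∀ k → k < m → ¬ P k)) step
  where
  step : ∀ n → (∀ {k} → k < n → P k → ∃ λ m → P m × (∀ k → k < m → ¬ P k)) →
    P n → ∃ λ m → P m × (∀ k → k < m → ¬ P k)
  step n rec Pn with anyUpTo? P? n
  ... | yes (k , k<n , Pk) = rec k<n Pk
  ... | no none            = n , Pn , λ k k<n Pk → none (k , k<n , Pk)

-- Divisibility

prime-divisor : ∀ n → .{{NonZero n}} → n ≢ 1 → ∃ λ p → Prime p × p ∣ n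
prime-divisor n n≢1 with factorise n
... | record { factors = []    ; isFactorisation = eq } = ⊥-elim (n≢1 eq)
... | record { factors = p ∷ _ ; isFactorisation = eq ; factorsPrime = pp ∷ _ } =
  p , pp , subst (p ∣_) (sym eq) (m∣m*n _)

prime≢1 : ∀ {p} → Prime p → p ≢ 1
prime≢1 pp refl = ¬prime[1] pp

prime∣prime : ∀ {p q} → Prime p → Prime q → p ∣ q → p ≡ q
prime∣prime pp pq p∣q with prime⇒irreducible pq p∣q
... | inj₁ p≡1 = ⊥-elim (prime≢1 pp p≡1)
... | inj₂ p≡q = p≡q

coprime-by-primes : ∀ {a n} → .{{NonZero n}} → (∀ p → Prime p → p ∣ a → ¬ p ∣ n) → Coprime a n
coprime-by-primes {a} {n} h {d} (d∣a , d∣n) with d ≟ 1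
... | yes d≡1 = d≡1
... | no  d≢1 with prime-divisor d {{≢-nonZero λ { refl → ≢-nonZero⁻¹ n (0∣⇒≡0 d∣n) }}} d≢1
...   | p , pp , p∣d = ⊥-elim (h p pp (∣-trans p∣d d∣a) (∣-trans p∣d d∣n))

-- For nonzero `n` this says that `n` is 1 or a power of the prime `q`, without naming the exponent.
OnlyPrime : ℕ → ℕ → Set
OnlyPrime q n = ∀ r → Prime r → r ∣ n → r ≡ q

prime∣^ : ∀ {p q} → Prime p → Prime q → ∀ v → p ∣ q ^ v → p ≡ q
prime∣^ pp pq zero    p∣1 = ⊥-elim (prime≢1 pp (∣1⇒≡1 p∣1))
prime∣^ {p} {q} pp pq (suc v) p∣ with euclidsLemma q (q ^ v) pp p∣
... | inj₁ p∣q = prime∣prime pp pq p∣q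
... | inj₂ p∣  = prime∣^ pp pq v p∣

prime-part : ∀ {q} → Prime q → ∀ n → .{{NonZero n}} → ∃ λ v → ∃ λ k → n ≡ q ^ v * k × ¬ q ∣ k
prime-part {q} pq n = <-rec (λ n → .{{NonZero n}} → ∃ λ v → ∃ λ k → n ≡ q ^ v * k × ¬ q ∣ k) step n
  where
  instance
    q-nonTrivial : NonTrivial q
    q-nonTrivial = prime⇒nonTrivial pq
  step : ∀ n → (∀ {m} → m < n → .{{NonZero m}} → ∃ λ v → ∃ λ k → m ≡ q ^ v * k × ¬ q ∣ k) →
    .{{NonZero n}} → ∃ λ v → ∃ λ k → n ≡ q ^ v * k × ¬ q ∣ k
  step n rec with q ∣? n
  ... | no q∤n  = 0 , n , sym (+-identityʳ n) , q∤n
  ... | yes q∣n with rec (quotient-< q∣n) {{quotient≢0 q∣n}}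
  ...   | v , k , eq , q∤k = suc v , k ,
    trans (m∣n⇒n≡m*quotient q∣n) (trans (cong (q *_) eq) (sym (*-assoc q (q ^ v) k))) , q∤k

-- Take a prime `q` dividing `n / m` and the full `q`-part `q ^ v` of `n`. Since `q ^ v` cannot
-- divide `m`, comparability gives `m ∣ q ^ v`; comparing `m` with a prime divisor `r` of `n` then
-- forces `r ≡ q`.
comparable-divisor : ∀ {n m} → .{{NonZero n}} → m ∣ n → m ≢ n → m ≢ 1 →
  (∀ d → d ∣ n → d ∣ m ⊎ m ∣ d) → ∃ λ q → OnlyPrime q n
comparable-divisor {n} {m} m∣n@(divides e n≡em) m≢n m≢1 comp
  with prime-divisor e {{quotient≢0 m∣n}} (λ { refl → m≢n (sym (trans n≡em (+-identityʳ m))) })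
... | q , pq , q∣e@(divides e′ e≡) with prime-part pq n
...   | v , k , n≡ , q∤k = q , only
  where
  instance
    qv-nonZero : NonZero (q ^ v)
    qv-nonZero = m^n≢0 q v {{prime⇒nonZero pq}}
  m∣qv : m ∣ q ^ v
  m∣qv with comp (q ^ v) (divides k (trans n≡ (*-comm (q ^ v) k)))
  ... | inj₂ p = p
  ... | inj₁ (divides c m≡) = ⊥-elim (q∤k (divides (e′ * c) (*-cancelʳ-≡ k (e′ * c * q) (q ^ v) (begin
      k * q ^ v               ≡⟨ *-comm k (q ^ v) ⟩
      q ^ v * k               ≡⟨ sym n≡ ⟩
      n                       ≡⟨ n≡em ⟩
      e * m                   ≡⟨ cong₂ _*_ e≡ m≡ ⟩
      (e′ * q) * (c * q ^ v)  ≡⟨ sym (*-assoc (e′ * q) c (q ^ v)) ⟩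
      (e′ * q * c) * q ^ v    ≡⟨ cong (_* q ^ v) (trans (*-assoc e′ q c) (trans (cong (e′ *_) (*-comm q c)) (sym (*-assoc e′ c q)))) ⟩
      (e′ * c * q) * q ^ v    ∎))))
    where open ≡-Reasoning
  only : OnlyPrime q n
  only r pr r∣n with comp r r∣n
  ... | inj₁ r∣m = prime∣^ pr pq v (∣-trans r∣m m∣qv)
  ... | inj₂ m∣r with prime⇒irreducible pr m∣r
  ...   | inj₁ m≡1  = ⊥-elim (m≢1 m≡1)
  ...   | inj₂ refl = prime∣^ pr pq v m∣qv

OnlyPrime-∣ : ∀ {q m n} → m ∣ n → OnlyPrime q n → OnlyPrime q m
OnlyPrime-∣ m∣n o r pr r∣m = o r pr (∣-trans r∣m m∣n)

OnlyPrime⇒q∣ : ∀ {q n} → .{{NonZero n}} → OnlyPrime q n → n ≢ 1 → q ∣ n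
OnlyPrime⇒q∣ {n = n} o n≢1 with prime-divisor n n≢1
... | r , pr , r∣n = subst (_∣ n) (o r pr r∣n) r∣n

-- One factor `q` is cancelled from each number until one of them is 1.
OnlyPrime-chain : ∀ {q} a b → .{{NonZero a}} → .{{NonZero b}} → OnlyPrime q a → OnlyPrime q b → a ∣ b ⊎ b ∣ a
OnlyPrime-chain {q} a = <-rec (λ a → ∀ b → .{{NonZero a}} → .{{NonZero b}} → OnlyPrime q a → OnlyPrime q b → a ∣ b ⊎ b ∣ a) step a
  where
  step : ∀ a → (∀ {c} → c < a → ∀ b → .{{NonZero c}} → .{{NonZero b}} → OnlyPrime q c → OnlyPrime q b → c ∣ b ⊎ b ∣ c) →
    ∀ b → .{{NonZero a}} → .{{NonZero b}} → OnlyPrime q a → OnlyPrime q b → a ∣ b ⊎ b ∣ a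
  step a rec b oa ob with a ≟ 1 | b ≟ 1
  ... | yes refl | _        = inj₁ (1∣ b)
  ... | _        | yes refl = inj₂ (1∣ a)
  ... | no a≢1   | no b≢1 with prime-divisor a a≢1
  ...   | r , pr , r∣a with oa r pr r∣a
  ...     | refl with OnlyPrime⇒q∣ ob b≢1
  ...       | q∣b with rec (quotient-< r∣a {{prime⇒nonTrivial pr}}) (quotient q∣b)
                       {{quotient≢0 r∣a}} {{quotient≢0 q∣b}}
                       (OnlyPrime-∣ (quotient-∣ r∣a) oa) (OnlyPrime-∣ (quotient-∣ q∣b) ob)
  ...         | inj₁ d = inj₁ (subst₂ _∣_ (sym (m∣n⇒n≡m*quotient r∣a)) (sym (m∣n⇒n≡m*quotient q∣b)) (*-monoʳ-∣ q d))
  ...         | inj₂ d = inj₂ (subst₂ _∣_ (sym (m∣n⇒n≡m*quotient q∣b)) (sym (m∣n⇒n≡m*quotient r∣a)) (*-monoʳ-∣ q d))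

-- Cyclic subgroups

module Cyclic (G : FinGroup) where
  open FinGroup G public using (_∙_; ε)
  open FinGroup G using (isGroup) renaming (n to N)

  private
    group : Group _ _
    group = record { isGroup = isGroup }
  open Group group using (assoc; identityˡ; identityʳ)
  open GroupProperties group public using (∙-cancelˡ)
  open GroupProperties group using (∙-cancelʳ)

  infixr 30 _↑_
  _↑_ : Elt G → ℕ → Elt G
  _↑_ = pow G

  ↑-+ : ∀ x a b → x ↑ (a + b) ≡ x ↑ a ∙ x ↑ b
  ↑-+ x zero    b = sym (identityˡ _)
  ↑-+ x (suc a) b = trans (cong (x ∙_) (↑-+ x a b)) (sym (assoc x (x ↑ a) (x ↑ b)))

  ↑-* : ∀ x a b → x ↑ (a * b) ≡ (x ↑ a) ↑ b
  ↑-* x a zero    = cong (x ↑_) (*-zeroʳ a)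
  ↑-* x a (suc b) = begin
    x ↑ (a * suc b)       ≡⟨ cong (x ↑_) (*-suc a b) ⟩
    x ↑ (a + a * b)       ≡⟨ ↑-+ x a (a * b) ⟩
    x ↑ a ∙ x ↑ (a * b)   ≡⟨ cong (x ↑ a ∙_) (↑-* x a b) ⟩
    x ↑ a ∙ (x ↑ a) ↑ b   ∎
    where open ≡-Reasoning

  ↑-1 : ∀ x → x ↑ 1 ≡ x
  ↑-1 = identityʳ

  ε↑ : ∀ a → ε ↑ a ≡ ε
  ε↑ zero    = refl
  ε↑ (suc a) = trans (identityˡ _) (ε↑ a)

  ↑-cancel : ∀ x a b → x ↑ (a + b) ≡ x ↑ a → x ↑ b ≡ ε
  ↑-cancel x a b e = ∙-cancelˡ (x ↑ a) _ _ (trans (sym (↑-+ x a b)) (trans e (sym (identityʳ _))))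

  private abstract
    -- Two of the first `N + 1` powers coincide, so some positive power is trivial. Recording the
    -- least period as `suc d` makes `ord x` visibly nonzero.
    period : ∀ x → ∃ λ d → x ↑ suc d ≡ ε × (∀ k → k < d → x ↑ suc k ≢ ε)
    period x with pigeonhole (n<1+n N) (λ i → x ↑ toℕ i)
    ... | i , j , i<j , eq = least (λ d → x ↑ suc d ≡ ε) (λ d → x ↑ suc d ≟ᶠ ε) (toℕ j ∸ suc (toℕ i))
      (↑-cancel x (toℕ i) _ (trans (cong (x ↑_) (trans (+-suc (toℕ i) _) (m+[n∸m]≡n i<j))) (sym eq)))

  ord : Elt G → ℕ
  ord x = suc (proj₁ (period x))

  ↑-ord : ∀ x → x ↑ ord x ≡ ε
  ↑-ord x = proj₁ (proj₂ (period x))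

  ord-minimal : ∀ x k → suc k < ord x → x ↑ suc k ≢ ε
  ord-minimal x k (s≤s k<) = proj₂ (proj₂ (period x)) k k<

  ∣⇒↑≡ε : ∀ x {a} → ord x ∣ a → x ↑ a ≡ ε
  ∣⇒↑≡ε x (divides k refl) = begin
    x ↑ (k * ord x)   ≡⟨ cong (x ↑_) (*-comm k (ord x)) ⟩
    x ↑ (ord x * k)   ≡⟨ ↑-* x (ord x) k ⟩
    (x ↑ ord x) ↑ k   ≡⟨ cong (_↑ k) (↑-ord x) ⟩
    ε ↑ k             ≡⟨ ε↑ k ⟩
    ε                 ∎
    where open ≡-Reasoning

  ↑-% : ∀ x a → x ↑ (a % ord x) ≡ x ↑ a
  ↑-% x a = sym (begin
    x ↑ a                                          ≡⟨ cong (x ↑_) (m≡m%n+[m/n]*n a (ord x)) ⟩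
    x ↑ (a % ord x + a / ord x * ord x)            ≡⟨ ↑-+ x (a % ord x) _ ⟩
    x ↑ (a % ord x) ∙ x ↑ (a / ord x * ord x)      ≡⟨ cong (x ↑ (a % ord x) ∙_) (∣⇒↑≡ε x (divides (a / ord x) refl)) ⟩
    x ↑ (a % ord x) ∙ ε                            ≡⟨ identityʳ _ ⟩
    x ↑ (a % ord x)                                ∎)
    where open ≡-Reasoning

  ↑≡ε⇒∣ : ∀ x {a} → x ↑ a ≡ ε → ord x ∣ a
  ↑≡ε⇒∣ x {a} e with a % ord x in eq
  ... | zero  = m%n≡0⇒n∣m a (ord x) eq
  ... | suc k = ⊥-elim (ord-minimal x k (subst (_< ord x) eq (m%n<n a (ord x)))
                  (trans (cong (x ↑_) (sym eq)) (trans (↑-% x a) e)))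

  private
    ↑-difference : ∀ x {a b} → a ≤ b → x ↑ a ≡ x ↑ b → ord x ∣ b ∸ a
    ↑-difference x {a} {b} a≤b e =
      ↑≡ε⇒∣ x (↑-cancel x a (b ∸ a) (trans (cong (x ↑_) (m+[n∸m]≡n a≤b)) (sym e)))

    ↑-difference⁻ : ∀ x {a b} → a ≤ b → ord x ∣ b ∸ a → x ↑ a ≡ x ↑ b
    ↑-difference⁻ x {a} {b} a≤b d = sym (begin
      x ↑ b                  ≡⟨ cong (x ↑_) (sym (m+[n∸m]≡n a≤b)) ⟩
      x ↑ (a + (b ∸ a))      ≡⟨ ↑-+ x a (b ∸ a) ⟩
      x ↑ a ∙ x ↑ (b ∸ a)    ≡⟨ cong (x ↑ a ∙_) (∣⇒↑≡ε x d) ⟩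
      x ↑ a ∙ ε              ≡⟨ identityʳ _ ⟩
      x ↑ a                  ∎)
      where open ≡-Reasoning

    ↑-injective-≤ : ∀ x {a b} → a ≤ b → b < ord x → x ↑ a ≡ x ↑ b → a ≡ b
    ↑-injective-≤ x {a} {b} a≤b b< e with b ∸ a in eq | ↑-difference x a≤b e
    ... | zero  | _ = ≤-antisym a≤b (m∸n≡0⇒m≤n eq)
    ... | suc k | d = ⊥-elim (<⇒≱ b< (≤-trans (∣⇒≤ d) (≤-trans (≤-reflexive (sym eq)) (m∸n≤m b a))))

  ↑-injective : ∀ x {a b} → a < ord x → b < ord x → x ↑ a ≡ x ↑ b → a ≡ b
  ↑-injective x {a} {b} a< b< e with ≤-total a b
  ... | inj₁ a≤b = ↑-injective-≤ x a≤b b< e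
  ... | inj₂ b≤a = sym (↑-injective-≤ x b≤a a< (sym e))

  -- The two truncated differences, one of which is always 0, together express congruence of the
  -- exponents modulo `ord x`.
  ↑-≡⇒ : ∀ x a b → x ↑ a ≡ x ↑ b → ord x ∣ b ∸ a × ord x ∣ a ∸ b
  ↑-≡⇒ x a b e with ≤-total a b
  ... | inj₁ a≤b = ↑-difference x a≤b e , subst (ord x ∣_) (sym (m≤n⇒m∸n≡0 a≤b)) (ord x ∣0)
  ... | inj₂ b≤a = subst (ord x ∣_) (sym (m≤n⇒m∸n≡0 b≤a)) (ord x ∣0) , ↑-difference x b≤a (sym e)

  ⇒↑-≡ : ∀ x a b → ord x ∣ b ∸ a × ord x ∣ a ∸ b → x ↑ a ≡ x ↑ b
  ⇒↑-≡ x a b (d , d′) with ≤-total a b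
  ... | inj₁ a≤b = ↑-difference⁻ x a≤b d
  ... | inj₂ b≤a = sym (↑-difference⁻ x b≤a d′)

  infix 4 _⊑_ _⊏_ _~_

  _⊑_ _⊏_ _~_ Comp : Elt G → Elt G → Set
  z ⊑ x    = InCyc G z x
  y ⊏ x    = y ⊑ x × ¬ x ⊑ y
  x ~ y    = x ⊑ y × y ⊑ x
  Comp x y = x ⊑ y ⊎ y ⊑ x

  ⊑-refl : ∀ {x} → x ⊑ x
  ⊑-refl {x} = 1 , sym (↑-1 x)

  ⊑-trans : ∀ {x y z} → x ⊑ y → y ⊑ z → x ⊑ z
  ⊑-trans {z = z} (a , refl) (b , refl) = b * a , sym (↑-* z b a)

  ↑⊑ : ∀ x a → x ↑ a ⊑ x
  ↑⊑ x a = a , refl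

  ε⊑ : ∀ x → ε ⊑ x
  ε⊑ x = 0 , refl

  ⊑ε⇒≡ε : ∀ {x} → x ⊑ ε → x ≡ ε
  ⊑ε⇒≡ε (a , refl) = ε↑ a

  -- Reducing the exponent modulo `ord x` bounds it, which makes `⊑` decidable by a finite search.
  dlog : ∀ {z x} → z ⊑ x → ∃ λ k → k < ord x × z ≡ x ↑ k
  dlog {x = x} (a , refl) = a % ord x , m%n<n a (ord x) , sym (↑-% x a)

  _⊑?_ : ∀ z x → Dec (z ⊑ x)
  z ⊑? x with any? (λ (i : Fin (ord x)) → z ≟ᶠ x ↑ toℕ i)
  ... | yes (i , e) = yes (toℕ i , e)
  ... | no none     = no λ p → let k , k< , e = dlog p in
                        none (fromℕ< k< , trans e (cong (x ↑_) (sym (toℕ-fromℕ< k<))))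

  _~?_ : ∀ x y → Dec (x ~ y)
  x ~? y = (x ⊑? y) ×-dec (y ⊑? x)

  comp? : ∀ x y → Dec (Comp x y)
  comp? x y = (x ⊑? y) ⊎-dec (y ⊑? x)

  ~-refl : ∀ {x} → x ~ x
  ~-refl = ⊑-refl , ⊑-refl

  ~-sym : ∀ {x y} → x ~ y → y ~ x
  ~-sym (a , b) = b , a

  ~-trans : ∀ {x y z} → x ~ y → y ~ z → x ~ z
  ~-trans (a , b) (c , d) = ⊑-trans a c , ⊑-trans d b

  CycSub⇒⊑ : ∀ {x y} → CycSub G x y → x ⊑ y
  CycSub⇒⊑ {x} s = s x ⊑-refl

  ⊑⇒CycSub : ∀ {x y} → x ⊑ y → CycSub G x y
  ⊑⇒CycSub p z q = ⊑-trans q p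

  SameCls⇒~ : ∀ {x y} → SameCls G x y → x ~ y
  SameCls⇒~ (a , b) = CycSub⇒⊑ a , CycSub⇒⊑ b

  ~⇒SameCls : ∀ {x y} → x ~ y → SameCls G x y
  ~⇒SameCls (a , b) = ⊑⇒CycSub a , ⊑⇒CycSub b

  -- The inverse of `b` is `b ↑ pred (ord b)`, so natural exponents reach inverses too.
  ∙≡ε⇒⊑ : ∀ {a b v} → a ∙ b ≡ ε → b ⊑ v → a ⊑ v
  ∙≡ε⇒⊑ {a} {b} e b⊑v = ⊑-trans (pred (ord b) , ∙-cancelʳ b a _ (trans e (sym (begin
      b ↑ pred (ord b) ∙ b        ≡⟨ cong (b ↑ pred (ord b) ∙_) (sym (↑-1 b)) ⟩
      b ↑ pred (ord b) ∙ b ↑ 1    ≡⟨ sym (↑-+ b (pred (ord b)) 1) ⟩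
      b ↑ (pred (ord b) + 1)      ≡⟨ cong (b ↑_) (+-comm (pred (ord b)) 1) ⟩
      b ↑ ord b                   ≡⟨ ↑-ord b ⟩
      ε                           ∎)))) b⊑v
    where open ≡-Reasoning

  -- The exponents below `ord x` and the elements of the cyclic subgroup inject into each other.
  -- Orders written as counts can be bounded by injections of elements.
  ord-count : ∀ x → ord x ≡ count (_⊑? x)
  ord-count x = ≤-antisym
    (subst (_≤ count (_⊑? x)) (count-⊤ (ord x))
      (count-injection (λ _ → yes tt) (_⊑? x) (λ i → x ↑ toℕ i) (λ i _ → ↑⊑ x (toℕ i))
        (λ i j _ _ e → toℕ-injective (↑-injective x (toℕ<n i) (toℕ<n j) e))))
    (subst (count (_⊑? x) ≤_) (count-⊤ (ord x))
      (count-injection (_⊑? x) (λ _ → yes tt) log (λ _ _ → tt)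
        (λ y z y⊑ z⊑ e → trans (sym (x↑log y y⊑)) (trans (cong (λ i → x ↑ toℕ i) e) (x↑log z z⊑)))))
    where
    log : Elt G → Fin (ord x)
    log z with z ⊑? x
    ... | yes p = fromℕ< (proj₁ (proj₂ (dlog p)))
    ... | no _  = Fin.zero
    x↑log : ∀ z → z ⊑ x → x ↑ toℕ (log z) ≡ z
    x↑log z p with z ⊑? x
    ... | yes q = trans (cong (x ↑_) (toℕ-fromℕ< (proj₁ (proj₂ (dlog q))))) (sym (proj₂ (proj₂ (dlog q))))
    ... | no ¬p = ⊥-elim (¬p p)

  ⊑⇒ord∣ : ∀ {u v} → u ⊑ v → ord u ∣ ord v
  ⊑⇒ord∣ {u} {v} (a , refl) = ↑≡ε⇒∣ u (begin
    (v ↑ a) ↑ ord v    ≡⟨ sym (↑-* v a (ord v)) ⟩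
    v ↑ (a * ord v)    ≡⟨ ∣⇒↑≡ε v (divides a refl) ⟩
    ε                  ∎)
    where open ≡-Reasoning

  ~⇒ord≡ : ∀ {u v} → u ~ v → ord u ≡ ord v
  ~⇒ord≡ (a , b) = ∣-antisym (⊑⇒ord∣ a) (⊑⇒ord∣ b)

  ord-↑ : ∀ x g {h} → ord x ≡ g * h → ord (x ↑ g) ≡ h
  ord-↑ x zero    ()
  ord-↑ x g@(suc _) {h} e = ∣-antisym
    (↑≡ε⇒∣ (x ↑ g) (trans (sym (↑-* x g h)) (∣⇒↑≡ε x (subst (ord x ∣_) e ∣-refl))))
    (*-cancelˡ-∣ g (subst (_∣ g * ord (x ↑ g)) e
      (↑≡ε⇒∣ x (trans (↑-* x g (ord (x ↑ g))) (↑-ord (x ↑ g))))))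

  -- By Bézout the gcd is a combination of `a` and `ord x`, and multiples of `ord x` vanish in the
  -- exponent. With natural coefficients one sign case exhibits the power directly, the other its
  -- inverse.
  ↑-gcd⊑ : ∀ x a → x ↑ gcd a (ord x) ⊑ x ↑ a
  ↑-gcd⊑ x a with Bézout.identity (gcd-GCD a (ord x))
  ... | Bézout.+- k l eq = k , (begin
      x ↑ g                     ≡⟨ sym (identityʳ _) ⟩
      x ↑ g ∙ ε                 ≡⟨ cong (x ↑ g ∙_) (sym (∣⇒↑≡ε x (divides l refl))) ⟩
      x ↑ g ∙ x ↑ (l * ord x)   ≡⟨ sym (↑-+ x g (l * ord x)) ⟩
      x ↑ (g + l * ord x)       ≡⟨ cong (x ↑_) (trans eq (*-comm k a)) ⟩
      x ↑ (a * k)               ≡⟨ ↑-* x a k ⟩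
      (x ↑ a) ↑ k               ∎)
    where
    open ≡-Reasoning
    g = gcd a (ord x)
  ... | Bézout.-+ k l eq = ∙≡ε⇒⊑ {b = x ↑ (k * a)} (begin
      x ↑ g ∙ x ↑ (k * a)       ≡⟨ sym (↑-+ x g (k * a)) ⟩
      x ↑ (g + k * a)           ≡⟨ cong (x ↑_) eq ⟩
      x ↑ (l * ord x)           ≡⟨ ∣⇒↑≡ε x (divides l refl) ⟩
      ε                         ∎)
      (k , trans (cong (x ↑_) (*-comm k a)) (↑-* x a k))
    where
    open ≡-Reasoning
    g = gcd a (ord x)

  ↑-∣-⊑ : ∀ x {a b} → b ∣ a → x ↑ a ⊑ x ↑ b
  ↑-∣-⊑ x {b = b} (divides c refl) = c , trans (cong (x ↑_) (*-comm c b)) (↑-* x b c)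

  -- The exponent of `u` is replaced by its gcd with `ord x`, which is the index of the subgroup;
  -- subgroups are then compared through divisibility of exponents.
  divisor-rep : ∀ {u x} → u ⊑ x → ∃ λ g → ord x ≡ g * ord u × u ~ x ↑ g
  divisor-rep {u} {x} (a , refl) = g , trans e (cong (g *_) (sym ord-u)) , u~
    where
    g = gcd a (ord x)
    g∣ord : g ∣ ord x
    g∣ord = gcd[m,n]∣n a (ord x)
    e : ord x ≡ g * quotient g∣ord
    e = m∣n⇒n≡m*quotient g∣ord
    u~ : x ↑ a ~ x ↑ g
    u~ = ↑-∣-⊑ x (gcd[m,n]∣m a (ord x)) , ↑-gcd⊑ x a
    ord-u : ord (x ↑ a) ≡ quotient g∣ord
    ord-u = trans (~⇒ord≡ u~) (ord-↑ x g e)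

  -- A cyclic group has one subgroup per divisor of its order.
  ord∣⇒⊑ : ∀ {u v x} → u ⊑ x → v ⊑ x → ord u ∣ ord v → u ⊑ v
  ord∣⇒⊑ {u} {v} {x} p q (divides c e) with divisor-rep p | divisor-rep q
  ... | g , eg , (u⊑ , _) | h , eh , (_ , ⊑v) = ⊑-trans u⊑ (⊑-trans (↑-∣-⊑ x (divides c
      (*-cancelʳ-≡ g (c * h) (ord u) (begin
        g * ord u          ≡⟨ sym eg ⟩
        ord x              ≡⟨ eh ⟩
        h * ord v          ≡⟨ cong (h *_) e ⟩
        h * (c * ord u)    ≡⟨ sym (*-assoc h c (ord u)) ⟩
        h * c * ord u      ≡⟨ cong (_* ord u) (*-comm h c) ⟩
        c * h * ord u      ∎)))) ⊑v)
    where open ≡-Reasoning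

  ord≡⇒~ : ∀ {u v x} → u ⊑ x → v ⊑ x → ord u ≡ ord v → u ~ v
  ord≡⇒~ p q e = ord∣⇒⊑ p q (∣-reflexive e) , ord∣⇒⊑ q p (∣-reflexive (sym e))

  element-of-order : ∀ x {d} → d ∣ ord x → ∃ λ u → u ⊑ x × ord u ≡ d
  element-of-order x d∣ = x ↑ quotient d∣ , ↑⊑ x (quotient d∣) , ord-↑ x (quotient d∣) (m∣n⇒n≡quotient*m d∣)

  ord≡1⇒≡ε : ∀ {x} → ord x ≡ 1 → x ≡ ε
  ord≡1⇒≡ε {x} e = trans (sym (↑-1 x)) (trans (cong (x ↑_) (sym e)) (↑-ord x))

  coprime⇒generator : ∀ x {a} → Coprime a (ord x) → x ↑ a ~ x
  coprime⇒generator x {a} c = ↑⊑ x a ,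
    subst (_⊑ x ↑ a) (trans (cong (x ↑_) (coprime⇒gcd≡1 c)) (↑-1 x)) (↑-gcd⊑ x a)

  -- For a common divisor `d`, `x` lies in the subgroup of `x ↑ d`, so dividing `ord x` by `d` must
  -- leave it unchanged.
  generator⇒coprime : ∀ x {a} → x ⊑ x ↑ a → Coprime a (ord x)
  generator⇒coprime x {a} p {d} (d∣a , d∣n) = *-cancelʳ-≡ d 1 (quotient d∣n) {{quotient≢0 d∣n}} (begin
      d * quotient d∣n   ≡⟨ sym e ⟩
      ord x              ≡⟨ ~⇒ord≡ (⊑-trans p (↑-∣-⊑ x d∣a) , ↑⊑ x d) ⟩
      ord (x ↑ d)        ≡⟨ ord-↑ x d e ⟩
      quotient d∣n       ≡⟨ sym (+-identityʳ _) ⟩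
      1 * quotient d∣n   ∎)
    where
    open ≡-Reasoning
    e = m∣n⇒n≡m*quotient d∣n

  OnlyPrime⇒Comp : ∀ {q u v x} → OnlyPrime q (ord x) → u ⊑ x → v ⊑ x → Comp u v
  OnlyPrime⇒Comp {u = u} {v} o p r
    with OnlyPrime-chain (ord u) (ord v) (OnlyPrime-∣ (⊑⇒ord∣ p) o) (OnlyPrime-∣ (⊑⇒ord∣ r) o)
  ... | inj₁ d = inj₁ (ord∣⇒⊑ p r d)
  ... | inj₂ d = inj₂ (ord∣⇒⊑ r p d)

  -- Numbers of generators: `gens x` is Euler's totient of `ord x`.

  gens : Elt G → ℕ
  gens x = count (_~? x)

  gens-~ : ∀ {x y} → x ~ y → gens x ≤ gens y
  gens-~ {x} {y} e = count-mono (_~? x) (_~? y) (λ z p → ~-trans p e)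

  -- Compares the generators of a cyclic group with those of its subgroup of prime index `q`,
  -- generated by `y`. The injection takes a `q`-th root if `q ∣ m`, and otherwise multiplies by the
  -- element `x ↑ m` of order `q`.
  module PrimeIndex {q m} (pq : Prime q) (x : Elt G) (e : ord x ≡ q * m) where
    private
      instance
        q-nonZero : NonZero q
        q-nonZero = prime⇒nonZero pq
      y = x ↑ q
      ord-y : ord y ≡ m
      ord-y = ord-↑ x q e
      m-nonZero : NonZero m
      m-nonZero = subst NonZero ord-y _
      coprime-ord : ∀ {a} → (∀ p → Prime p → p ∣ a → p ∣ q ⊎ p ∣ m → ⊥) → Coprime a (ord x)
      coprime-ord {a} h = coprime-by-primes λ p pp p∣a p∣n → h p pp p∣a (euclidsLemma q m pp (subst (p ∣_) e p∣n))

      log : Elt G → ℕ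
      log z with z ⊑? y
      ... | yes p = proj₁ (dlog p)
      ... | no _  = 0
      log< : ∀ {z} → z ⊑ y → log z < m
      log< {z} p with z ⊑? y
      ... | yes r = subst (log-r <_) ord-y (proj₁ (proj₂ (dlog r))) where log-r = proj₁ (dlog r)
      ... | no ¬p = ⊥-elim (¬p p)
      y↑log : ∀ {z} → z ⊑ y → z ≡ y ↑ log z
      y↑log {z} p with z ⊑? y
      ... | yes r = proj₂ (proj₂ (dlog r))
      ... | no ¬p = ⊥-elim (¬p p)
      log-coprime : ∀ {z} → z ~ y → Coprime (log z) m
      log-coprime (z⊑ , ⊑z) = subst (Coprime _) ord-y (generator⇒coprime y (subst (y ⊑_) (y↑log z⊑) ⊑z))

    module Divides (q∣m : q ∣ m) where
      private
        root : Elt G → Elt G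
        root z = x ↑ log z
        root-inverse : ∀ {z} → z ⊑ y → z ≡ root z ↑ q
        root-inverse {z} p = trans (y↑log p) (trans (sym (↑-* x q (log z)))
          (trans (cong (x ↑_) (*-comm q (log z))) (↑-* x (log z) q)))
        -- As `q ∣ m`, every prime dividing `ord x` divides `m`, so an exponent coprime to `m` gives
        -- a generator.
        into : ∀ z → z ~ y → root z ~ x
        into z p = coprime⇒generator x (coprime-ord λ r pr r∣log r∣ →
          prime≢1 pr (log-coprime p (r∣log , [ (λ r∣q → ∣-trans r∣q q∣m) , (λ r∣m → r∣m) ] r∣)))
        missed : x ↑ suc m ~ x
        missed = coprime⇒generator x (coprime-ord λ r pr r∣ r∣qm →
          prime≢1 pr (∣1⇒≡1 (∣m+n∣m⇒∣n (subst (r ∣_) (+-comm 1 m) r∣)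
            ([ (λ r∣q → ∣-trans r∣q q∣m) , (λ r∣m → r∣m) ] r∣qm))))
        2≤q : 2 ≤ q
        2≤q = nonTrivial⇒n>1 q {{prime⇒nonTrivial pq}}
        suc-m< : suc m < ord x
        suc-m< = begin-strict
          suc m         <⟨ +-monoˡ-< m (≤-trans 2≤q (∣⇒≤ {{m-nonZero}} q∣m)) ⟩
          m + m         ≡⟨ cong (m +_) (sym (+-identityʳ m)) ⟩
          2 * m         ≤⟨ *-monoˡ-≤ m 2≤q ⟩
          q * m         ≡⟨ sym e ⟩
          ord x         ∎
          where open ≤-Reasoning

      -- The roots have exponents below `m`, so they miss the exponent `m + 1`, which is coprime to
      -- `m` and hence to `ord x`.
      gens-< : gens y < gens x
      gens-< = count-injection-< (_~? y) (_~? x) root into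
        (λ z z′ p p′ eq → trans (root-inverse (proj₁ p)) (trans (cong (_↑ q) eq) (sym (root-inverse (proj₁ p′)))))
        (x ↑ suc m) missed
        (λ z p eq → <⇒≢ (m<n⇒m<1+n (log< (proj₁ p)))
          (↑-injective x (<-trans (m<n⇒m<1+n (log< (proj₁ p))) suc-m<) suc-m< eq))

    module NotDivides (q∤m : ¬ q ∣ m) where
      private
        w = x ↑ m
        -- The orders `m` of `z` and `q` of `w` are coprime, so the product has full order; the
        -- proof tests the exponent `q * log z + m` against the primes dividing `q` or `m`.
        into : ∀ z → z ~ y → z ∙ w ~ x
        into z p = subst (_~ x) (sym z∙w) (coprime⇒generator x (coprime-ord no-prime))
          where
          z∙w : z ∙ w ≡ x ↑ (q * log z + m)
          z∙w = trans (cong (_∙ w) (trans (y↑log (proj₁ p)) (sym (↑-* x q (log z))))) (sym (↑-+ x (q * log z) m))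
          no-prime : ∀ r → Prime r → r ∣ q * log z + m → r ∣ q ⊎ r ∣ m → ⊥
          no-prime r pr r∣ (inj₁ r∣q) with prime∣prime pr pq r∣q
          ... | refl = q∤m (∣m+n∣m⇒∣n r∣ (m∣m*n (log z)))
          no-prime r pr r∣ (inj₂ r∣m)
            with euclidsLemma q (log z) pr (∣m+n∣m⇒∣n (subst (r ∣_) (+-comm (q * log z) m) r∣) r∣m)
          ... | inj₁ r∣q   = q∤m (subst (_∣ m) (prime∣prime pr pq r∣q) r∣m)
          ... | inj₂ r∣log = prime≢1 pr (log-coprime p (r∣log , r∣m))
        inj : ∀ z z′ → z ~ y → z′ ~ y → z ∙ w ≡ z′ ∙ w → z ≡ z′
        inj z z′ _ _ eq = ∙-cancelʳ w z z′ eq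

      gens-≤ : gens y ≤ gens x
      gens-≤ = count-injection (_~? y) (_~? x) (_∙ w) into inj

      -- The missed generator is `y` times the square of `w`, which again has order `q` because `q`
      -- is odd. Were it equal to `z ∙ w`, then `z` would be `x ↑ (q + m)`, and `z ↑ m ≡ ε` would
      -- force `q ∣ m`.
      gens-< : q ≢ 2 → gens y < gens x
      gens-< q≢2 = count-injection-< (_~? y) (_~? x) (_∙ w) into inj (x ↑ (q + m) ∙ w) missed not-hit
        where
        missed : x ↑ (q + m) ∙ w ~ x
        missed = subst (_~ x) (↑-+ x (q + m) m) (coprime⇒generator x (coprime-ord no-prime))
          where
          no-prime : ∀ r → Prime r → r ∣ q + m + m → r ∣ q ⊎ r ∣ m → ⊥
          no-prime r pr r∣ (inj₁ r∣q) with prime∣prime pr pq r∣q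
          ... | refl with euclidsLemma 2 m pr (subst (r ∣_) (cong (m +_) (sym (+-identityʳ m)))
                          (∣m+n∣m⇒∣n (subst (r ∣_) (+-assoc q m m) r∣) r∣q))
          ...   | inj₁ q∣2 = q≢2 (prime∣prime pq prime[2] q∣2)
          ...   | inj₂ q∣m = q∤m q∣m
          no-prime r pr r∣ (inj₂ r∣m) = q∤m (subst (_∣ m) (prime∣prime pr pq r∣q) r∣m)
            where
            r∣q : r ∣ q
            r∣q = ∣m+n∣m⇒∣n (subst (r ∣_) (trans (+-assoc q m m) (+-comm q (m + m))) r∣) (∣m∣n⇒∣m+n r∣m r∣m)
        not-hit : ∀ z → z ~ y → z ∙ w ≢ x ↑ (q + m) ∙ w
        not-hit z p eq = q∤m (∣m+n∣m⇒∣n (*-cancelʳ-∣ m {{m-nonZero}} (subst (_∣ (q + m) * m) e (↑≡ε⇒∣ x (begin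
            x ↑ ((q + m) * m)     ≡⟨ ↑-* x (q + m) m ⟩
            (x ↑ (q + m)) ↑ m     ≡⟨ cong (_↑ m) (sym (∙-cancelʳ w z _ eq)) ⟩
            z ↑ m                 ≡⟨ ∣⇒↑≡ε z (subst (ord z ∣_) ord-y (⊑⇒ord∣ (proj₁ p))) ⟩
            ε                     ∎)))) ∣-refl)
          where open ≡-Reasoning

    gens-≤ : gens y ≤ gens x
    gens-≤ with q ∣? m
    ... | yes d = <⇒≤ (Divides.gens-< d)
    ... | no ¬d = NotDivides.gens-≤ ¬d

    gens-≥⇒2 : gens x ≤ gens y → q ≡ 2 × ¬ q ∣ m
    gens-≥⇒2 h with q ∣? m | q ≟ 2
    ... | yes d | _        = ⊥-elim (<⇒≱ (Divides.gens-< d) h)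
    ... | no ¬d | yes q≡2  = q≡2 , ¬d
    ... | no ¬d | no q≢2   = ⊥-elim (<⇒≱ (NotDivides.gens-< ¬d q≢2) h)

  private
    split : ∀ {q g n} (q∣g : q ∣ g) (g∣n : g ∣ n) → n ≡ q * (quotient q∣g * quotient g∣n)
    split {q} {g} {n} q∣g g∣n = trans (m∣n⇒n≡m*quotient g∣n)
      (trans (cong (_* quotient g∣n) (m∣n⇒n≡m*quotient q∣g)) (*-assoc q _ _))

    ↑-split : ∀ x {q g} (q∣g : q ∣ g) → x ↑ g ≡ (x ↑ q) ↑ quotient q∣g
    ↑-split x {q} q∣g = trans (cong (x ↑_) (m∣n⇒n≡m*quotient q∣g)) (↑-* x q _)

    ∣ord-nonZero : ∀ {g} x → g ∣ ord x → NonZero g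
    ∣ord-nonZero x g∣n = ≢-nonZero λ { refl → 0≢1+n (sym (0∣⇒≡0 g∣n)) }

  -- Strong induction on `g`, descending by one subgroup of prime index for each prime factor.
  gens-↑-≤ : ∀ g x → g ∣ ord x → gens (x ↑ g) ≤ gens x
  gens-↑-≤ = <-rec (λ g → ∀ x → g ∣ ord x → gens (x ↑ g) ≤ gens x) step
    where
    step : ∀ g → (∀ {c} → c < g → ∀ x → c ∣ ord x → gens (x ↑ c) ≤ gens x) →
      ∀ x → g ∣ ord x → gens (x ↑ g) ≤ gens x
    step g rec x g∣n with g ≟ 1
    ... | yes refl = ≤-reflexive (cong gens (↑-1 x))
    ... | no g≢1 with prime-divisor g {{∣ord-nonZero x g∣n}} g≢1
    ...   | q , pq , q∣g = begin
        gens (x ↑ g)                      ≡⟨ cong gens (↑-split x q∣g) ⟩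
        gens ((x ↑ q) ↑ quotient q∣g)     ≤⟨ rec (quotient-< q∣g {{prime⇒nonTrivial pq}} {{∣ord-nonZero x g∣n}}) (x ↑ q)
                                               (subst (quotient q∣g ∣_) (sym (ord-↑ x q (split q∣g g∣n))) (m∣m*n (quotient g∣n))) ⟩
        gens (x ↑ q)                      ≤⟨ PrimeIndex.gens-≤ pq x (split q∣g g∣n) ⟩
        gens x                            ∎
      where open ≤-Reasoning

  gens-≤ : ∀ {y x} → y ⊑ x → gens y ≤ gens x
  gens-≤ {y} {x} p with divisor-rep p
  ... | g , e , y~ = ≤-trans (gens-~ y~) (gens-↑-≤ g x (divides (ord y) (trans e (*-comm g (ord y)))))

  -- By monotonicity the bound also holds at index `r` for each prime `r` dividing `g`, so `r` is 2
  -- and `ord x` is twice an odd number. A second prime factor of `g` would also be 2 and would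
  -- divide that odd number.
  gens-↑-≥ : ∀ g x → g ∣ ord x → g ≢ 1 → gens x ≤ gens (x ↑ g) → g ≡ 2
  gens-↑-≥ g x g∣n g≢1 h = index-2 (prime-divisor g g≢1)
    where
    instance
      g-nonZero : NonZero g
      g-nonZero = ∣ord-nonZero x g∣n
    prime-bound : ∀ {r} → Prime r → (r∣g : r ∣ g) → r ≡ 2 × ¬ r ∣ quotient r∣g * quotient g∣n
    prime-bound {r} pr r∣g = PrimeIndex.gens-≥⇒2 pr x (split r∣g g∣n)
      (≤-trans h (gens-≤ (subst (_⊑ x ↑ r) (sym (↑-split x r∣g)) (↑⊑ (x ↑ r) (quotient r∣g)))))
    index-2 : (∃ λ p → Prime p × p ∣ g) → g ≡ 2
    index-2 (q , pq , q∣g) with prime-bound pq q∣g | quotient q∣g ≟ 1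
    ... | refl , _  | yes c≡1 = trans (m∣n⇒n≡quotient*m q∣g) (cong (_* 2) c≡1)
    ... | refl , 2∤ | no c≢1 with prime-divisor (quotient q∣g) {{quotient≢0 q∣g}} c≢1
    ...   | r , pr , r∣c with prime-bound pr (∣-trans r∣c (quotient-∣ q∣g))
    ...     | refl , _ = ⊥-elim (2∤ (∣m⇒∣m*n _ r∣c))

  -- Equality in gens y ≤ gens x forces index at most 2, and a cyclic group has at most one subgroup of index 2.
  gens-incomparable : ∀ {x y z} → y ⊏ x → z ⊏ x → gens x ≤ gens y → gens x ≤ gens z → y ~ z
  gens-incomparable {x} {y} {z} (y⊑x , x⋢y) (z⊑x , x⋢z) hy hz =
    ord≡⇒~ y⊑x z⊑x (*-cancelˡ-≡ (ord y) (ord z) 2 (trans (sym (half y⊑x x⋢y hy)) (half z⊑x x⋢z hz)))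
    where
    half : ∀ {u} → u ⊑ x → ¬ x ⊑ u → gens x ≤ gens u → ord x ≡ 2 * ord u
    half {u} p ¬p h with divisor-rep p
    ... | g , e , u~ = trans e (cong (_* ord u) (gens-↑-≥ g x (divides (ord u) (trans e (*-comm g (ord u))))
      (λ { refl → ¬p (subst (_⊑ u) (↑-1 x) (proj₂ u~)) }) (≤-trans h (gens-~ u~))))

-- Twins in the power graph

module Twins (G : FinGroup) where
  open Cyclic G public

  infix 4 _≈_ _≈?_

  Comp-sym : ∀ {x y} → Comp x y → Comp y x
  Comp-sym = [ inj₂ , inj₁ ]

  Comp-~ : ∀ {x y z} → x ~ y → Comp z x → Comp z y
  Comp-~ (x⊑y , y⊑x) (inj₁ p) = inj₁ (⊑-trans p x⊑y)
  Comp-~ (x⊑y , y⊑x) (inj₂ p) = inj₂ (⊑-trans y⊑x p)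

  -- Closed twins in the power graph, except that ε is separated from the other dominating vertices.
  _≈_ : Elt G → Elt G → Set
  x ≈ y = ((x ≡ ε → y ≡ ε) × (y ≡ ε → x ≡ ε)) × (∀ z → (Comp z x → Comp z y) × (Comp z y → Comp z x))

  _≈?_ : ∀ x y → Dec (x ≈ y)
  x ≈? y = (((x ≟ᶠ ε) →-dec (y ≟ᶠ ε)) ×-dec ((y ≟ᶠ ε) →-dec (x ≟ᶠ ε)))
    ×-dec all? (λ z → (comp? z x →-dec comp? z y) ×-dec (comp? z y →-dec comp? z x))

  ≈-refl : ∀ {x} → x ≈ x
  ≈-refl = ((λ e → e) , (λ e → e)) , λ z → (λ c → c) , (λ c → c)

  ≈-sym : ∀ {x y} → x ≈ y → y ≈ x
  ≈-sym ((a , b) , t) = (b , a) , λ z → proj₂ (t z) , proj₁ (t z)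

  ≈-trans : ∀ {x y z} → x ≈ y → y ≈ z → x ≈ z
  ≈-trans ((a , b) , t) ((c , d) , s) = ((λ e → c (a e)) , (λ e → b (d e))) ,
    λ z → (λ p → proj₁ (s z) (proj₁ (t z) p)) , (λ p → proj₂ (t z) (proj₂ (s z) p))

  ~⇒≈ : ∀ {x y} → x ~ y → x ≈ y
  ~⇒≈ e@(x⊑y , y⊑x) = ((λ { refl → ⊑ε⇒≡ε y⊑x }) , (λ { refl → ⊑ε⇒≡ε x⊑y })) ,
    λ z → Comp-~ e , Comp-~ (~-sym e)

  ≈⇒Comp : ∀ {x y} → x ≈ y → Comp x y
  ≈⇒Comp {x} (_ , t) = proj₁ (t x) (inj₁ ⊑-refl)

  ≈-Comp : ∀ {x y z} → x ≈ y → Comp z x → Comp z y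
  ≈-Comp {z = z} (_ , t) = proj₁ (t z)

  -- Everything below `x` is comparable to its twin `y`, so `ord y` is comparable to every divisor
  -- of `ord x`. It is a proper divisor as `x` is not below `y`, and it is not 1 because `≈`
  -- separates `ε`.
  chain-below : ∀ {x y} → y ≈ x → y ⊏ x → ∃ λ q → OnlyPrime q (ord x)
  chain-below {x} {y} y≈x (y⊑x , x⋢y) = comparable-divisor (⊑⇒ord∣ y⊑x)
    (λ e → x⋢y (ord∣⇒⊑ ⊑-refl y⊑x (∣-reflexive (sym e))))
    (λ e → x⋢y (subst (_⊑ y) (sym (proj₁ (proj₁ y≈x) (ord≡1⇒≡ε e))) (ε⊑ y)))
    comparable
    where
    comparable : ∀ d → d ∣ ord x → d ∣ ord y ⊎ ord y ∣ d
    comparable d d∣ with element-of-order x d∣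
    ... | u , u⊑x , refl with ≈-Comp (≈-sym y≈x) (inj₁ u⊑x)
    ...   | inj₁ p = inj₁ (⊑⇒ord∣ p)
    ...   | inj₂ p = inj₂ (⊑⇒ord∣ p)

  -- If r ≠ q divided ord z, the element of order r·ord y in ⟨z⟩ would be comparable to y but not to x.
  chain-above : ∀ {x y} → y ≈ x → y ⊏ x → ∃ λ q → (∀ z → y ⊑ z → OnlyPrime q (ord z))
  chain-above {x} {y} y≈x y⊏x@(y⊑x , x⋢y) with chain-below y≈x y⊏x
  ... | q , only = q , above
    where
    above : ∀ z → y ⊑ z → OnlyPrime q (ord z)
    above z y⊑z r pr r∣z with r ≟ q
    ... | yes r≡q = r≡q
    ... | no r≢q = ⊥-elim (incomparable (element-of-order z rm∣z))
      where
      r∤x : ¬ r ∣ ord x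
      r∤x r∣x = r≢q (only r pr r∣x)
      m∣z = ⊑⇒ord∣ y⊑z
      rm∣z : r * ord y ∣ ord z
      rm∣z with euclidsLemma (quotient m∣z) (ord y) pr (subst (r ∣_) (m∣n⇒n≡quotient*m m∣z) r∣z)
      ... | inj₁ r∣c = subst (r * ord y ∣_) (sym (m∣n⇒n≡quotient*m m∣z)) (*-monoˡ-∣ (ord y) r∣c)
      ... | inj₂ r∣m = ⊥-elim (r∤x (∣-trans r∣m (⊑⇒ord∣ y⊑x)))
      coprime : Coprime (ord x) r
      coprime {d} (d∣x , d∣r) with prime⇒irreducible pr d∣r
      ... | inj₁ d≡1  = d≡1
      ... | inj₂ refl = ⊥-elim (r∤x d∣x)
      incomparable : (∃ λ w → w ⊑ z × ord w ≡ r * ord y) → ⊥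
      incomparable (w , w⊑z , e)
        with ≈-Comp y≈x (inj₂ (ord∣⇒⊑ y⊑z w⊑z (subst (ord y ∣_) (sym e) (n∣m*n r))))
      ... | inj₁ w⊑x = r∤x (∣-trans (subst (r ∣_) (sym e) (m∣m*n (ord y))) (⊑⇒ord∣ w⊑x))
      ... | inj₂ x⊑w = x⋢y (ord∣⇒⊑ ⊑-refl y⊑x
                         (coprime-divisor {m = ord x} {n = r} {o = ord y} coprime (subst (ord x ∣_) e (⊑⇒ord∣ x⊑w))))

  -- Whichever of `u` and `x` lies strictly below the other serves as the lower twin; `z` is above
  -- it in both cases.
  twin-prime : ∀ {u x z} → u ≈ x → ¬ u ~ x → x ⊑ z → ∃ λ q → OnlyPrime q (ord z)
  twin-prime {u} {x} {z} u≈x u≁x x⊑z with ≈⇒Comp u≈x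
  ... | inj₁ u⊑x = let q , above = chain-above u≈x (u⊑x , λ x⊑u → u≁x (u⊑x , x⊑u)) in
                     q , above z (⊑-trans u⊑x x⊑z)
  ... | inj₂ x⊑u = let q , above = chain-above (≈-sym u≈x) (x⊑u , λ u⊑x → u≁x (u⊑x , x⊑u)) in
                     q , above z x⊑z

  -- Unless all three generate the same subgroup, `c` has prime power order. Elements below `c` then
  -- form a chain through `b`, and elements above `c` are above `b`.
  ≈-convex : ∀ {a b c} → a ≈ c → a ⊑ b → b ⊑ c → b ≈ a
  ≈-convex {a} {b} {c} a≈c a⊑b b⊑c with c ⊑? a
  ... | yes c⊑a = ~⇒≈ (⊑-trans b⊑c c⊑a , a⊑b)
  ... | no c⋢a with chain-below a≈c (⊑-trans a⊑b b⊑c , c⋢a)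
  ...   | q , only = ((λ { refl → ⊑ε⇒≡ε a⊑b }) , λ a≡ε → ⊑ε⇒≡ε (subst (b ⊑_) (proj₁ (proj₁ a≈c) a≡ε) b⊑c)) ,
                          λ z → fwd , bwd
    where
    fwd : ∀ {z} → Comp z b → Comp z a
    fwd (inj₁ z⊑b) = ≈-Comp (≈-sym a≈c) (inj₁ (⊑-trans z⊑b b⊑c))
    fwd (inj₂ b⊑z) = inj₂ (⊑-trans a⊑b b⊑z)
    bwd : ∀ {z} → Comp z a → Comp z b
    bwd z∼a with ≈-Comp a≈c z∼a
    ... | inj₁ z⊑c = OnlyPrime⇒Comp only z⊑c b⊑c
    ... | inj₂ c⊑z = inj₂ (⊑-trans b⊑c c⊑z)

  -- The reverse comparison would put `b` between two twins, hence into their class by convexity.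
  -- Thus `⊑` between different classes ignores the choice of representative.
  ⊑-respˡ-≈ : ∀ {a a′ b} → a ≈ a′ → ¬ a ≈ b → a ⊑ b → a′ ⊑ b
  ⊑-respˡ-≈ a≈a′ a≉b a⊑b with ≈-Comp a≈a′ (inj₂ a⊑b)
  ... | inj₂ a′⊑b = a′⊑b
  ... | inj₁ b⊑a′ = ⊥-elim (a≉b (≈-sym (≈-convex a≈a′ a⊑b b⊑a′)))

  ⊑-respʳ-≈ : ∀ {a b b′} → b ≈ b′ → ¬ a ≈ b → a ⊑ b → a ⊑ b′
  ⊑-respʳ-≈ b≈b′ a≉b a⊑b with ≈-Comp b≈b′ (inj₁ a⊑b)
  ... | inj₁ a⊑b′ = a⊑b′
  ... | inj₂ b′⊑a = ⊥-elim (a≉b (≈-trans (≈-convex (≈-sym b≈b′) b′⊑a a⊑b) (≈-sym b≈b′)))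

  twins : Elt G → ℕ
  twins x = count (_≈? x)

  gens≤twins : ∀ x → gens x ≤ twins x
  gens≤twins x = count-mono (_~? x) (_≈? x) (λ _ → ~⇒≈)

  private
    OtherTwin : Elt G → Set
    OtherTwin x = ∃ λ u → u ≈ x × ¬ u ~ x

    otherTwin? : ∀ x → Dec (OtherTwin x)
    otherTwin? x = any? (λ u → (u ≈? x) ×-dec ¬? (u ~? x))

    twins≤gens : ∀ {x} → ¬ OtherTwin x → twins x ≤ gens x
    twins≤gens {x} none = count-mono (_≈? x) (_~? x) same
      where
      same : ∀ u → u ≈ x → u ~ x
      same u u≈x with u ~? x
      ... | yes p = p
      ... | no ¬p = ⊥-elim (none (u , u≈x , ¬p))

  -- When y generates a cyclic p-group and u is a non-generator, y ∙ u is again a generator.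
  twins-≤ : ∀ {x y} → x ⊑ y → ¬ x ≈ y → twins x ≤ twins y
  twins-≤ {x} {y} x⊑y x≉y with otherTwin? x
  ... | no none = ≤-trans (twins≤gens none) (≤-trans (gens-≤ x⊑y) (gens≤twins y))
  ... | yes (v , v≈x , v≁x) with twin-prime v≈x v≁x x⊑y
  ...   | q , only = count-injection (_≈? x) (_≈? y) (y ∙_) (λ u u≈x → ~⇒≈ (generator u u≈x))
                            (λ u u′ _ _ → ∙-cancelˡ y u u′)
    where
    generator : ∀ u → u ≈ x → y ∙ u ~ y
    generator u u≈x with ⊑-respˡ-≈ (≈-sym u≈x) x≉y x⊑y
    ... | a , refl = coprime⇒generator y (coprime-by-primes λ r pr r∣ r∣y →
          prime≢1 pr (∣1⇒≡1 (∣m+n∣m⇒∣n (subst (r ∣_) (+-comm 1 a) r∣) (subst (_∣ a) (sym (only r pr r∣y)) q∣a))))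
      where
      q∣a : q ∣ a
      q∣a with q ∣? a
      ... | yes d = d
      ... | no ¬d = ⊥-elim (x≉y (≈-trans (≈-sym u≈x) (~⇒≈ (coprime⇒generator y (coprime-by-primes λ r pr r∣a r∣y →
                      ¬d (subst (_∣ a) (only r pr r∣y) r∣a))))))

  -- If `y` or `z` had a twin generating another subgroup, `x` would have prime power order and `y`,
  -- `z` would be comparable. Otherwise the bounds pass to `gens`, where they force `y ~ z`.
  incomparable-twins : ∀ {x y z} → y ⊑ x → z ⊑ x → ¬ Comp z y → twins x ≤ twins y → twins x ≤ twins z → ⊥
  incomparable-twins {x} {y} {z} y⊑x z⊑x z≁y hy hz =
    z≁y (inj₂ (proj₁ (gens-incomparable (y⊑x , x⋢y) (z⊑x , x⋢z) (bound y⊑x hy) (bound z⊑x hz))))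
    where
    x⋢y : ¬ x ⊑ y
    x⋢y x⊑y = z≁y (inj₁ (⊑-trans z⊑x x⊑y))
    x⋢z : ¬ x ⊑ z
    x⋢z x⊑z = z≁y (inj₂ (⊑-trans y⊑x x⊑z))
    bound : ∀ {u} → u ⊑ x → twins x ≤ twins u → gens x ≤ gens u
    bound {u} u⊑x h with otherTwin? u
    ... | no none = ≤-trans (gens≤twins x) (≤-trans h (twins≤gens none))
    ... | yes (v , v≈u , v≁u) with twin-prime v≈u v≁u u⊑x
    ...   | q , only = ⊥-elim (z≁y (OnlyPrime⇒Comp only z⊑x y⊑x))

  Top : Elt G → Set
  Top t = ∀ u → u ≈ t → u ⊑ t

  abstract
    -- Twins are pairwise comparable, so a twin of greatest order lies above all the others.
    top-exists : ∀ y → ∃ λ t → t ≈ y × Top t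
    top-exists y with maximum (_≈? y) ord y ≈-refl
    ... | t , t≈y , max = t , t≈y , above
      where
      above : Top t
      above u u≈t with ≈⇒Comp u≈t
      ... | inj₁ u⊑t = u⊑t
      ... | inj₂ t⊑u = ord∣⇒⊑ ⊑-refl t⊑u (∣-reflexive (≤-antisym (max u (≈-trans u≈t t≈y)) (∣⇒≤ (⊑⇒ord∣ t⊑u))))

  top : Elt G → Elt G
  top y = proj₁ (top-exists y)

  top≈ : ∀ y → top y ≈ y
  top≈ y = proj₁ (proj₂ (top-exists y))

  top-Top : ∀ y → Top (top y)
  top-Top y = proj₂ (proj₂ (top-exists y))

  ≈⇒⊑top : ∀ {u y} → u ≈ y → u ⊑ top y
  ≈⇒⊑top {u} {y} u≈y = top-Top y u (≈-trans u≈y (≈-sym (top≈ y)))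

  -- Everything below `s` is a twin of `s` or lies below `y`; since `y` itself is counted on both
  -- sides, the bound is strict.
  ord-<-twins : ∀ {s y} → y ≈ s → y ⊏ s → ord s < twins s + ord y
  ord-<-twins {s} {y} y≈s y⊏s@(y⊑s , _) with chain-below y≈s y⊏s
  ... | q , only = begin-strict
      ord s                          ≡⟨ ord-count s ⟩
      count (_⊑? s)                  ≤⟨ count-mono (_⊑? s) ∪? cover ⟩
      count ∪?                       <⟨ m<m+n (count ∪?) (count-pos ∩? y (y≈s , ⊑-refl)) ⟩
      count ∪? + count ∩?            ≡⟨ sym (count-∪∩ (_≈? s) (_⊑? y)) ⟩
      twins s + count (_⊑? y)        ≡⟨ cong (twins s +_) (sym (ord-count y)) ⟩
      twins s + ord y                ∎
    where
    open ≤-Reasoning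
    ∪? = λ u → (u ≈? s) ⊎-dec (u ⊑? y)
    ∩? = λ u → (u ≈? s) ×-dec (u ⊑? y)
    cover : ∀ u → u ⊑ s → u ≈ s ⊎ u ⊑ y
    cover u u⊑s with OnlyPrime⇒Comp only u⊑s y⊑s
    ... | inj₁ u⊑y = inj₂ u⊑y
    ... | inj₂ y⊑u = inj₁ (≈-trans (≈-convex y≈s y⊑u u⊑s) y≈s)

  -- By convexity the class of `t` is disjoint from the subgroup of `v`, and both lie below `t`.
  twins-≤-ord : ∀ {t v} → Top t → v ⊑ t → ¬ v ≈ t → twins t + ord v ≤ ord t
  twins-≤-ord {t} {v} t-top v⊑t v≉t = begin
      twins t + ord v                ≡⟨ cong (twins t +_) (ord-count v) ⟩
      twins t + count (_⊑? v)        ≡⟨ count-∪∩ (_≈? t) (_⊑? v) ⟩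
      count ∪? + count ∩?            ≡⟨ cong (count ∪? +_) (count-none ∩? disjoint) ⟩
      count ∪? + 0                   ≡⟨ +-identityʳ _ ⟩
      count ∪?                       ≤⟨ count-mono ∪? (_⊑? t) inside ⟩
      count (_⊑? t)                  ≡⟨ sym (ord-count t) ⟩
      ord t                          ∎
    where
    open ≤-Reasoning
    ∪? = λ u → (u ≈? t) ⊎-dec (u ⊑? v)
    ∩? = λ u → (u ≈? t) ×-dec (u ⊑? v)
    disjoint : ∀ u → ¬ (u ≈ t × u ⊑ v)
    disjoint u (u≈t , u⊑v) = v≉t (≈-trans (≈-convex u≈t u⊑v v⊑t) u≈t)
    inside : ∀ u → u ≈ t ⊎ u ⊑ v → u ⊑ t
    inside u (inj₁ u≈t) = t-top u u≈t
    inside u (inj₂ u⊑v) = ⊑-trans u⊑v v⊑t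

-- Isomorphisms of power graphs

-- A power graph isomorphism normalised at `ε`, with the reflexive relation `Comp` in place of
-- adjacency. Both directions are stored, so that inverting it only swaps fields.
record CompIso (G₁ G₂ : FinGroup) : Set where
  private
    module T₁ = Twins G₁
    module T₂ = Twins G₂
  field
    to        : Elt G₁ → Elt G₂
    from      : Elt G₂ → Elt G₁
    from-to   : ∀ x → from (to x) ≡ x
    to-from   : ∀ y → to (from y) ≡ y
    to-comp   : ∀ {x y} → T₁.Comp x y → T₂.Comp (to x) (to y)
    from-comp : ∀ {x y} → T₂.Comp x y → T₁.Comp (from x) (from y)
    to-ε      : to T₁.ε ≡ T₂.ε
    from-ε    : from T₂.ε ≡ T₁.ε

flip : ∀ {G₁ G₂} → CompIso G₁ G₂ → CompIso G₂ G₁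
flip I = record
  { to = from ; from = to ; from-to = to-from ; to-from = from-to
  ; to-comp = from-comp ; from-comp = to-comp
  ; to-ε = from-ε ; from-ε = to-ε }
  where open CompIso I

module Transport {G₁ G₂ : FinGroup} (I : CompIso G₁ G₂) where
  open CompIso I
  module T₁ = Twins G₁
  module T₂ = Twins G₂

  to-injective : ∀ {x y} → to x ≡ to y → x ≡ y
  to-injective {x} {y} e = trans (sym (from-to x)) (trans (cong from e) (from-to y))

  to-comp⁻ : ∀ {x y} → T₂.Comp (to x) (to y) → T₁.Comp x y
  to-comp⁻ {x} {y} c = subst₂ T₁.Comp (from-to x) (from-to y) (from-comp c)

  to-≈ : ∀ {x y} → x T₁.≈ y → to x T₂.≈ to y
  to-≈ {x} {y} x≈y@((a , b) , _) = (to-ε-≡ a , to-ε-≡ b) , λ z → transfer x≈y , transfer (T₁.≈-sym x≈y)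
    where
    to-ε-≡ : ∀ {u v} → (u ≡ T₁.ε → v ≡ T₁.ε) → to u ≡ T₂.ε → to v ≡ T₂.ε
    to-ε-≡ h e = trans (cong to (h (to-injective (trans e (sym to-ε))))) to-ε
    transfer : ∀ {u v z} → u T₁.≈ v → T₂.Comp z (to u) → T₂.Comp z (to v)
    transfer {u} {v} {z} u≈v c = subst (λ w → T₂.Comp w (to v)) (to-from z)
      (to-comp (T₁.≈-Comp u≈v (to-comp⁻ (subst (λ w → T₂.Comp w (to u)) (sym (to-from z)) c))))

  twins-to : ∀ x → T₁.twins x ≤ T₂.twins (to x)
  twins-to x = count-injection (T₁._≈? x) (T₂._≈? to x) to (λ _ → to-≈) (λ _ _ _ _ → to-injective)

module Inversion {G₁ G₂ : FinGroup} (I : CompIso G₁ G₂) where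
  open CompIso I
  open Transport I public
  private
    module B = Transport (flip I)

  to-≈⁻ : ∀ {x y} → to x T₂.≈ to y → x T₁.≈ y
  to-≈⁻ {x} {y} e = subst₂ T₁._≈_ (from-to x) (from-to y) (B.to-≈ e)

  twins-to⁻ : ∀ x → T₂.twins (to x) ≤ T₁.twins x
  twins-to⁻ x = ≤-trans (B.twins-to (to x)) (≤-reflexive (cong T₁.twins (from-to x)))

  -- An inversion would make both y and z lie below x, with classes at least as large as that of x.
  no-inversion : ∀ {x y z} → y T₁.⊑ x → T₁.Comp z x → ¬ T₁.Comp z y → ¬ to x T₂.⊑ to y
  no-inversion {x} {y} {z} y⊑x z∼x z≁y x′⊑y′ =
    T₁.incomparable-twins y⊑x z⊑x z≁y (bound x′⊑y′ x′≉y′) (bound x′⊑z′ x′≉z′)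
    where
    z⊑x : z T₁.⊑ x
    z⊑x = [ (λ p → p) , (λ x⊑z → ⊥-elim (z≁y (inj₂ (T₁.⊑-trans y⊑x x⊑z)))) ] z∼x
    z′≁y′ : ¬ T₂.Comp (to z) (to y)
    z′≁y′ c = z≁y (to-comp⁻ c)
    x′⊑z′ : to x T₂.⊑ to z
    x′⊑z′ = [ (λ z′⊑x′ → ⊥-elim (z′≁y′ (inj₁ (T₂.⊑-trans z′⊑x′ x′⊑y′)))) , (λ p → p) ] (to-comp z∼x)
    x′≉y′ : ¬ to x T₂.≈ to y
    x′≉y′ e = z′≁y′ (T₂.≈-Comp e (to-comp z∼x))
    x′≉z′ : ¬ to x T₂.≈ to z
    x′≉z′ e = z′≁y′ (T₂.Comp-sym (T₂.≈-Comp e (inj₂ x′⊑y′)))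
    bound : ∀ {u} → to x T₂.⊑ to u → ¬ to x T₂.≈ to u → T₁.twins x ≤ T₁.twins u
    bound {u} p ¬e = ≤-trans (twins-to x) (≤-trans (T₂.twins-≤ p ¬e) (twins-to⁻ u))

module Orientation {G₁ G₂ : FinGroup} (I : CompIso G₁ G₂) where
  open CompIso I
  open Inversion I public
  private
    module B = Inversion (flip I)

  -- Comparability survives, so only a reversal has to be excluded. If `y` is not `ε`, then `x ≉ y`
  -- yields some `z` comparable to exactly one of them: `x` alone contradicts `no-inversion` for the
  -- isomorphism, `y` alone for its inverse.
  to-⊑ : ∀ {x y} → ¬ x T₁.≈ y → y T₁.⊑ x → to y T₂.⊑ to x
  to-⊑ {x} {y} x≉y y⊑x with to-comp {y} {x} (inj₁ y⊑x)
  ... | inj₁ p = p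
  ... | inj₂ x′⊑y′ with y ≟ᶠ T₁.ε
  ...   | yes refl = subst (T₂._⊑ to x) (sym to-ε) (T₂.ε⊑ (to x))
  ...   | no y≢ε with any? (λ z → T₁.comp? z x ×-dec ¬? (T₁.comp? z y))
  ...     | yes (z , z∼x , z≁y) = ⊥-elim (no-inversion y⊑x z∼x z≁y x′⊑y′)
  ...     | no none with any? (λ z → T₁.comp? z y ×-dec ¬? (T₁.comp? z x))
  ...       | yes (z , z∼y , z≁x) = ⊥-elim (B.no-inversion {to y} {to x} {to z} x′⊑y′ (to-comp z∼y)
                (λ c → z≁x (to-comp⁻ c)) (subst₂ T₁._⊑_ (sym (from-to y)) (sym (from-to x)) y⊑x))
  ...       | no none′ = ⊥-elim (x≉y (((λ { refl → T₁.⊑ε⇒≡ε y⊑x }) , (λ e → ⊥-elim (y≢ε e))) ,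
                λ z → dne none z , dne none′ z))
    where
    dne : ∀ {u v} → ¬ (∃ λ z → T₁.Comp z u × ¬ T₁.Comp z v) → ∀ z → T₁.Comp z u → T₁.Comp z v
    dne {u} {v} h z c with T₁.comp? z v
    ... | yes p = p
    ... | no ¬p = ⊥-elim (h (z , c , ¬p))

  -- Below `t`, twins of `t` are sent below `t′` because `t′` is greatest in its class, and all
  -- other elements because order between classes is preserved.
  ord-Top-≤ : ∀ {t t′} → T₂.Top t′ → to t T₂.≈ t′ → T₁.ord t ≤ T₂.ord t′
  ord-Top-≤ {t} {t′} t′-top e = subst₂ _≤_ (sym (T₁.ord-count t)) (sym (T₂.ord-count t′))
    (count-injection (T₁._⊑? t) (T₂._⊑? t′) to into (λ _ _ _ _ → to-injective))
    where
    into : ∀ z → z T₁.⊑ t → to z T₂.⊑ t′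
    into z z⊑t with t T₁.≈? z
    ... | yes t≈z = t′-top (to z) (T₂.≈-trans (T₂.≈-sym (to-≈ t≈z)) e)
    ... | no t≉z  = T₂.⊑-trans (to-⊑ t≉z z⊑t) (t′-top (to t) e)

module Reconstruction {G₁ G₂ : FinGroup} (I : CompIso G₁ G₂) where
  open CompIso I
  open Orientation I public
  private
    module B = Orientation (flip I)

  to-⊑⁻ : ∀ {x y} → ¬ x T₁.≈ y → to y T₂.⊑ to x → y T₁.⊑ x
  to-⊑⁻ {x} {y} x≉y p = subst₂ T₁._⊑_ (from-to y) (from-to x) (B.to-⊑ (λ e → x≉y (to-≈⁻ e)) p)

  ord-top : ∀ y → T₁.ord (T₁.top y) ≡ T₂.ord (T₂.top (to y))
  ord-top y = ≤-antisym
    (ord-Top-≤ (T₂.top-Top (to y)) (T₂.≈-trans (to-≈ (T₁.top≈ y)) (T₂.≈-sym (T₂.top≈ (to y)))))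
    (B.ord-Top-≤ (T₁.top-Top y) (T₁.≈-trans (B.to-≈ (T₂.top≈ (to y)))
      (subst (T₁._≈ T₁.top y) (sym (from-to y)) (T₁.≈-sym (T₁.top≈ y)))))

  private
    ord∣ : ∀ y → T₁.ord y ∣ T₂.ord (T₂.top (to y))
    ord∣ y = subst (T₁.ord y ∣_) (ord-top y) (T₁.⊑⇒ord∣ (T₁.≈⇒⊑top T₁.≈-refl))

  abstract
    -- Inside a class `to` need not preserve orders, so `τ y` is chosen by its order below the
    -- greatest element of the class; `ord-top` supplies the divisibility.
    τ-exists : ∀ y → ∃ λ u → u T₂.⊑ T₂.top (to y) × T₂.ord u ≡ T₁.ord y
    τ-exists y = T₂.element-of-order (T₂.top (to y)) (ord∣ y)

  τ : Elt G₁ → Elt G₂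
  τ y = proj₁ (τ-exists y)

  τ⊑top : ∀ y → τ y T₂.⊑ T₂.top (to y)
  τ⊑top y = proj₁ (proj₂ (τ-exists y))

  ord-τ : ∀ y → T₂.ord (τ y) ≡ T₁.ord y
  ord-τ y = proj₂ (proj₂ (τ-exists y))

  -- Otherwise the class of to y would be smaller than that of y.
  τ≈to : ∀ y → τ y T₂.≈ to y
  τ≈to y = cases (τ y T₂.≈? t) (s T₁.⊑? y)
    where
    open ≤-Reasoning
    s = T₁.top y
    t = T₂.top (to y)
    twins-s≤t : T₂.twins (to s) ≤ T₂.twins t
    twins-s≤t = count-mono (T₂._≈? to s) (T₂._≈? t)
      (λ u e → T₂.≈-trans e (T₂.≈-trans (to-≈ (T₁.top≈ y)) (T₂.≈-sym (T₂.top≈ (to y)))))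
    cases : Dec (τ y T₂.≈ t) → Dec (s T₁.⊑ y) → τ y T₂.≈ to y
    cases (yes e) _         = T₂.≈-trans e (T₂.top≈ (to y))
    cases (no ¬e) (yes s⊑y) = ⊥-elim (¬e (T₂.~⇒≈ (T₂.ord≡⇒~ (τ⊑top y) T₂.⊑-refl (trans (ord-τ y)
      (trans (T₁.~⇒ord≡ (T₁.≈⇒⊑top T₁.≈-refl , s⊑y)) (ord-top y))))))
    cases (no ¬e) (no s⋢y)  = ⊥-elim (<-irrefl refl (begin-strict
      T₁.ord s                   <⟨ T₁.ord-<-twins (T₁.≈-sym (T₁.top≈ y)) (T₁.≈⇒⊑top T₁.≈-refl , s⋢y) ⟩
      T₁.twins s + T₁.ord y      ≤⟨ +-monoˡ-≤ (T₁.ord y) (≤-trans (twins-to s) twins-s≤t) ⟩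
      T₂.twins t + T₁.ord y      ≡⟨ cong (T₂.twins t +_) (sym (ord-τ y)) ⟩
      T₂.twins t + T₂.ord (τ y)  ≤⟨ T₂.twins-≤-ord (T₂.top-Top (to y)) (τ⊑top y) ¬e ⟩
      T₂.ord t                   ≡⟨ sym (ord-top y) ⟩
      T₁.ord s                   ∎))

  -- Within a class both images lie below one greatest element, where orders decide. Between classes
  -- `τ` may be exchanged for `to`.
  τ-⊑ : ∀ {x y} → x T₁.⊑ y → τ x T₂.⊑ τ y
  τ-⊑ {x} {y} p with y T₁.≈? x
  ... | yes e = T₂.ord∣⇒⊑ (T₂.≈⇒⊑top (T₂.≈-trans (τ≈to x) (T₂.≈-sym (to-≈ e)))) (τ⊑top y)
                  (subst₂ _∣_ (sym (ord-τ x)) (sym (ord-τ y)) (T₁.⊑⇒ord∣ p))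
  ... | no ¬e = T₂.⊑-respʳ-≈ (T₂.≈-sym (τ≈to y)) (λ e → ¬e′ (T₂.≈-trans (T₂.≈-sym (τ≈to x)) e))
                  (T₂.⊑-respˡ-≈ (T₂.≈-sym (τ≈to x)) ¬e′ (to-⊑ ¬e p))
    where
    ¬e′ : ¬ to x T₂.≈ to y
    ¬e′ e = ¬e (T₁.≈-sym (to-≈⁻ e))

  τ-⊑⁻ : ∀ {x y} → τ x T₂.⊑ τ y → x T₁.⊑ y
  τ-⊑⁻ {x} {y} p with y T₁.≈? x
  ... | yes e = T₁.ord∣⇒⊑ (T₁.≈⇒⊑top (T₁.≈-sym e)) (T₁.≈⇒⊑top T₁.≈-refl)
                  (subst₂ _∣_ (ord-τ x) (ord-τ y) (T₂.⊑⇒ord∣ p))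
  ... | no ¬e = to-⊑⁻ ¬e (T₂.⊑-respʳ-≈ (τ≈to y) (λ e → ¬e′ (T₂.≈-trans (τ≈to x) e))
                  (T₂.⊑-respˡ-≈ (τ≈to x) ¬e′ p))
    where
    ¬e′ : ¬ τ x T₂.≈ τ y
    ¬e′ e = ¬e (T₁.≈-sym (to-≈⁻ (T₂.≈-trans (T₂.≈-sym (τ≈to x)) (T₂.≈-trans e (τ≈to y)))))

-- The round trip preserves the class and the order, which determine the subgroup below `top x`.
τ-inverse : ∀ {G₁ G₂} (I : CompIso G₁ G₂) → let open Cyclic G₁ in
  ∀ x → Reconstruction.τ (flip I) (Reconstruction.τ I x) ~ x
τ-inverse {G₁} I x = T₁.ord≡⇒~ (T₁.≈⇒⊑top back) (T₁.≈⇒⊑top T₁.≈-refl)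
  (trans (B.ord-τ (τ x)) (ord-τ x))
  where
  open CompIso I
  open Reconstruction I
  module B = Reconstruction (flip I)
  back : B.τ (τ x) T₁.≈ x
  back = T₁.≈-trans (B.τ≈to (τ x)) (subst (from (τ x) T₁.≈_) (from-to x) (B.to-≈ (τ≈to x)))

-- Bijections between classes, and the quotient order.

module SameOrder {G₁ G₂ : FinGroup} (x : Elt G₁) (x′ : Elt G₂)
                 (ord≡ : Cyclic.ord G₁ x ≡ Cyclic.ord G₂ x′) where
  private
    module C₁ = Cyclic G₁
    module C₂ = Cyclic G₂

  -- This makes `transfer` well defined: equality of powers depends only on the exponents modulo the
  -- common order.
  ↑-≡-transfer : ∀ a b → x C₁.↑ a ≡ x C₁.↑ b → x′ C₂.↑ a ≡ x′ C₂.↑ b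
  ↑-≡-transfer a b e with C₁.↑-≡⇒ x a b e
  ... | d , d′ = C₂.⇒↑-≡ x′ a b (subst (_∣ b ∸ a) ord≡ d , subst (_∣ a ∸ b) ord≡ d′)

  transfer : Elt G₁ → Elt G₂
  transfer z with z C₁.⊑? x
  ... | yes (k , _) = x′ C₂.↑ k
  ... | no _        = C₂.ε

  transfer-↑ : ∀ k → transfer (x C₁.↑ k) ≡ x′ C₂.↑ k
  transfer-↑ k with (x C₁.↑ k) C₁.⊑? x
  ... | yes (l , e) = sym (↑-≡-transfer k l e)
  ... | no ¬p       = ⊥-elim (¬p (C₁.↑⊑ x k))

  transfer-~ : ∀ z → x C₁.~ z → x′ C₂.~ transfer z
  transfer-~ z ((j , e) , (k , refl)) = subst (x′ C₂.~_) (sym (transfer-↑ k))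
    ((j , (begin
      x′                     ≡⟨ sym (C₂.↑-1 x′) ⟩
      x′ C₂.↑ 1              ≡⟨ ↑-≡-transfer 1 (k * j) (trans (C₁.↑-1 x) (trans e (sym (C₁.↑-* x k j)))) ⟩
      x′ C₂.↑ (k * j)        ≡⟨ C₂.↑-* x′ k j ⟩
      (x′ C₂.↑ k) C₂.↑ j     ∎)) , C₂.↑⊑ x′ k)
    where open ≡-Reasoning

ord≡⇒Equinum : ∀ {G₁ G₂} x x′ → Cyclic.ord G₁ x ≡ Cyclic.ord G₂ x′ → Equinum (SameCls G₁ x) (SameCls G₂ x′)
ord≡⇒Equinum {G₁} {G₂} x x′ e =
  A.transfer , B.transfer ,
  (λ z p → C₂.~⇒SameCls (A.transfer-~ z (C₁.SameCls⇒~ p))) ,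
  (λ z p → C₁.~⇒SameCls (B.transfer-~ z (C₂.SameCls⇒~ p))) ,
  (λ z p → A-inverse (proj₂ (C₁.SameCls⇒~ p))) , (λ z p → B-inverse (proj₂ (C₂.SameCls⇒~ p)))
  where
  module C₁ = Cyclic G₁
  module C₂ = Cyclic G₂
  module A = SameOrder {G₁} {G₂} x x′ e
  module B = SameOrder {G₂} {G₁} x′ x (sym e)
  A-inverse : ∀ {z} → z C₁.⊑ x → B.transfer (A.transfer z) ≡ z
  A-inverse (k , refl) = trans (cong B.transfer (A.transfer-↑ k)) (B.transfer-↑ k)
  B-inverse : ∀ {z} → z C₂.⊑ x′ → A.transfer (B.transfer z) ≡ z
  B-inverse (k , refl) = trans (cong A.transfer (B.transfer-↑ k)) (A.transfer-↑ k)

module _ (G : FinGroup) (o : ClassOrder G) where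
  open Cyclic G

  -- Together with its converse this identifies the quotient order with `⊑` on representatives,
  -- whatever the class order.
  QLe⇒⊑ : ∀ {x y} → QLe G o x y → x ⊑ y
  QLe⇒⊑ (inj₁ (p , _)) = CycSub⇒⊑ p
  QLe⇒⊑ {x} {y} (inj₂ h) with h x y (~⇒SameCls ~-refl) (~⇒SameCls ~-refl)
  ... | inj₁ ((p , _) , _) = CycSub⇒⊑ p
  ... | inj₂ (p , _)       = CycSub⇒⊑ p

  ⊑⇒QLe : ∀ {x y} → x ⊑ y → QLe G o x y
  ⊑⇒QLe {x} {y} x⊑y with y ⊑? x
  ... | yes y⊑x = inj₁ (~⇒SameCls (x⊑y , y⊑x))
  ... | no y⋢x  = inj₂ λ a b a∼x b∼y → let a⊑x , x⊑a = SameCls⇒~ a∼x ; b⊑y , y⊑b = SameCls⇒~ b∼y in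
    inj₂ (⊑⇒CycSub (⊑-trans a⊑x (⊑-trans x⊑y y⊑b)) ,
          λ b⊆a → y⋢x (⊑-trans y⊑b (⊑-trans (CycSub⇒⊑ b⊆a) a⊑x)))

CompIso⇒QuotIso : ∀ {G₁ G₂} o₁ o₂ → CompIso G₁ G₂ → QuotIso G₁ G₂ o₁ o₂
CompIso⇒QuotIso {G₁} {G₂} o₁ o₂ I = record
  { τ       = A.τ
  ; τ⁻      = B.τ
  ; τ-resp  = λ x y p → let a , b = C₁.SameCls⇒~ p in C₂.~⇒SameCls (A.τ-⊑ a , A.τ-⊑ b)
  ; τ⁻-resp = λ x y p → let a , b = C₂.SameCls⇒~ p in C₁.~⇒SameCls (B.τ-⊑ a , B.τ-⊑ b)
  ; invˡ    = λ x → C₁.~⇒SameCls (τ-inverse I x)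
  ; invʳ    = λ y → C₂.~⇒SameCls (τ-inverse (flip I) y)
  ; order   = λ x y → mk⇔ (λ p → ⊑⇒QLe G₂ o₂ (A.τ-⊑ (QLe⇒⊑ G₁ o₁ p)))
                          (λ p → ⊑⇒QLe G₁ o₁ (A.τ-⊑⁻ (QLe⇒⊑ G₂ o₂ p)))
  ; card    = λ x → ord≡⇒Equinum {G₁} {G₂} x (A.τ x) (sym (A.ord-τ x))
  }
  where
  module A = Reconstruction I
  module B = Reconstruction (flip I)
  module C₁ = Cyclic G₁
  module C₂ = Cyclic G₂

-- Ranks within classes

module Rank (G : FinGroup) (o : ClassOrder G) where
  open Cyclic G
  open ClassOrder o renaming (trans to lt-trans)

  LT : Elt G → Elt G → Set
  LT x y = x ~ y × lt x y

  LT-irrefl : ∀ {x} → ¬ LT x x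
  LT-irrefl {x} (_ , l) = irrefl x l

  LT-trans : ∀ {x y z} → LT x y → LT y z → LT x z
  LT-trans (e , l) (e′ , l′) = ~-trans e e′ , lt-trans _ _ _ (~⇒SameCls e) (~⇒SameCls e′) l l′

  LT-compare : ∀ {x y} → x ~ y → x ≡ y ⊎ LT x y ⊎ LT y x
  LT-compare {x} {y} e with x ≟ᶠ y
  ... | yes x≡y = inj₁ x≡y
  ... | no x≢y with total x y (~⇒SameCls e) x≢y
  ...   | inj₁ l = inj₂ (inj₁ (e , l))
  ...   | inj₂ l = inj₂ (inj₂ (~-sym e , l))

  -- `lt` carries no decision procedure; on a class it is decided by trichotomy.
  LT? : ∀ x y → Dec (LT x y)
  LT? x y with x ~? y
  ... | no x≁y = no (x≁y ∘ proj₁)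
  ... | yes e with LT-compare e
  ...   | inj₁ refl      = no LT-irrefl
  ...   | inj₂ (inj₁ l)  = yes l
  ...   | inj₂ (inj₂ l)  = no λ l′ → LT-irrefl (LT-trans l l′)

  rank : Elt G → ℕ
  rank x = count (λ z → LT? z x)

  rank-mono : ∀ {x y} → LT x y → rank x < rank y
  rank-mono {x} {y} l = count-mono-< (λ z → LT? z x) (λ z → LT? z y) (λ z l′ → LT-trans l′ l) x l LT-irrefl

  rank-injective : ∀ {x y} → x ~ y → rank x ≡ rank y → x ≡ y
  rank-injective e r with LT-compare e
  ... | inj₁ x≡y      = x≡y
  ... | inj₂ (inj₁ l) = ⊥-elim (<⇒≢ (rank-mono l) r)
  ... | inj₂ (inj₂ l) = ⊥-elim (<⇒≢ (rank-mono l) (sym r))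

  rank-mono⁻ : ∀ {x y} → x ~ y → rank x < rank y → LT x y
  rank-mono⁻ e r with LT-compare e
  ... | inj₁ refl     = ⊥-elim (<-irrefl refl r)
  ... | inj₂ (inj₁ l) = l
  ... | inj₂ (inj₂ l) = ⊥-elim (<-asym r (rank-mono l))

  rank<gens : ∀ x → rank x < gens x
  rank<gens x = count-mono-< (λ z → LT? z x) (_~? x) (λ z → proj₁) x ~-refl LT-irrefl

  abstract
    -- If no element had rank `r`, the ranks would inject a class of `gens x` elements into fewer
    -- than `gens x` values.
    rank-surjective : ∀ x r → r < gens x → ∃ λ w → w ~ x × rank w ≡ r
    rank-surjective x r r< with any? (λ w → (w ~? x) ×-dec (rank w ≟ r))
    ... | yes p   = p
    ... | no none = ⊥-elim (<-irrefl refl (subst (gens x <_) (count-⊤ (gens x))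
          (count-injection-< (_~? x) (λ _ → yes tt) rankᶠ (λ _ _ → tt) inj (fromℕ< r<) tt missed)))
      where
      rank< : ∀ {z} → z ~ x → rank z < gens x
      rank< {z} e = <-≤-trans (rank<gens z) (gens-~ e)
      rankᶠ : Elt G → Fin (gens x)
      rankᶠ z with rank z <? gens x
      ... | yes p = fromℕ< p
      -- A filler value outside the class; `r` shows that `Fin (gens x)` is inhabited.
      ... | no _  = fromℕ< r<
      rankᶠ-≡ : ∀ {z} → z ~ x → ∃ λ (p : rank z < gens x) → rankᶠ z ≡ fromℕ< p
      rankᶠ-≡ {z} e with rank z <? gens x
      ... | yes p = p , refl
      ... | no ¬p = ⊥-elim (¬p (rank< e))
      inj : ∀ y z → y ~ x → z ~ x → rankᶠ y ≡ rankᶠ z → y ≡ z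
      inj y z ey ez e with rankᶠ-≡ ey | rankᶠ-≡ ez
      ... | p , ep | q , eq = rank-injective (~-trans ey (~-sym ez))
            (fromℕ<-injective _ _ p q (trans (sym ep) (trans e eq)))
      missed : ∀ z → z ~ x → rankᶠ z ≢ fromℕ< r<
      missed z ez e with rankᶠ-≡ ez
      ... | p , ep = none (z , ez , fromℕ<-injective _ _ p r< (trans (sym ep) e))

  Prec⇒ : ∀ {x y} → Prec G o x y → LT x y ⊎ x ⊏ y
  Prec⇒ (inj₁ (s , l))  = inj₁ (SameCls⇒~ s , l)
  Prec⇒ (inj₂ (s , ¬s)) = inj₂ (CycSub⇒⊑ s , ¬s ∘ ⊑⇒CycSub)

  ⇒Prec : ∀ {x y} → LT x y ⊎ x ⊏ y → Prec G o x y
  ⇒Prec (inj₁ (s , l))  = inj₁ (~⇒SameCls s , l)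
  ⇒Prec (inj₂ (s , ¬s)) = inj₂ (⊑⇒CycSub s , ¬s ∘ CycSub⇒⊑)

  Prec⇒≢ : ∀ {x y} → Prec G o x y → x ≢ y
  Prec⇒≢ p refl with Prec⇒ p
  ... | inj₁ l        = LT-irrefl l
  ... | inj₂ (s , ¬s) = ¬s s

  Prec⇒⊑ : ∀ {x y} → Prec G o x y → x ⊑ y
  Prec⇒⊑ = [ proj₁ ∘ proj₁ , proj₁ ] ∘ Prec⇒

  ⊑⇒Prec : ∀ {x y} → x ≢ y → x ⊑ y → Prec G o x y ⊎ Prec G o y x
  ⊑⇒Prec {x} {y} x≢y x⊑y with y ⊑? x
  ... | no y⋢x = inj₁ (⇒Prec (inj₂ (x⊑y , y⋢x)))
  ... | yes y⊑x with LT-compare (x⊑y , y⊑x)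
  ...   | inj₁ x≡y      = ⊥-elim (x≢y x≡y)
  ...   | inj₂ (inj₁ l) = inj₁ (⇒Prec (inj₁ l))
  ...   | inj₂ (inj₂ l) = inj₂ (⇒Prec (inj₁ l))

-- The power graph as a comparability graph, and dominating vertices.

module _ (G : FinGroup) where
  open Twins G

  PArc⇒ : ∀ {x y} → PArc G x y → x ≢ y × y ⊑ x
  PArc⇒ (x≢y , m , e) = x≢y , suc m , e

  ⇒PArc : ∀ {x y} → x ≢ y × y ⊑ x → PArc G x y
  -- Arcs ask for a positive exponent, so exponent 0 is replaced by `ord x`.
  ⇒PArc {x} (x≢y , zero , refl)  = x≢y , pred (ord x) , sym (↑-ord x)
  ⇒PArc     (x≢y , suc m , e)    = x≢y , m , e

  PAdj⇒ : ∀ {x y} → PAdj G x y → x ≢ y × Comp x y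
  PAdj⇒ (inj₁ a) = proj₁ (PArc⇒ a) , inj₂ (proj₂ (PArc⇒ a))
  PAdj⇒ (inj₂ a) = proj₁ (PArc⇒ a) ∘ sym , inj₁ (proj₂ (PArc⇒ a))

  ⇒PAdj : ∀ {x y} → x ≢ y × Comp x y → PAdj G x y
  ⇒PAdj (x≢y , inj₁ p) = inj₂ (⇒PArc (x≢y ∘ sym , p))
  ⇒PAdj (x≢y , inj₂ p) = inj₁ (⇒PArc (x≢y , p))

  module _ (o : ClassOrder G) where
    open Rank G o

    PAdj⇒Prec : ∀ {x y} → PAdj G x y → Prec G o x y ⊎ Prec G o y x
    PAdj⇒Prec a with PAdj⇒ a
    ... | x≢y , inj₁ p = ⊑⇒Prec x≢y p
    ... | x≢y , inj₂ p = [ inj₂ , inj₁ ] (⊑⇒Prec (x≢y ∘ sym) p)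

    Prec⇒PAdj : ∀ {x y} → Prec G o x y ⊎ Prec G o y x → PAdj G x y
    Prec⇒PAdj (inj₁ p) = ⇒PAdj (Prec⇒≢ p , inj₁ (Prec⇒⊑ p))
    Prec⇒PAdj (inj₂ p) = ⇒PAdj (Prec⇒≢ p ∘ sym , inj₂ (Prec⇒⊑ p))

  Dominating : Elt G → Set
  Dominating x = ∀ y → Comp x y

  transpose-cases : ∀ {i j} → Dominating i → Dominating j → ∀ k →
    (Dominating k × Dominating (transpose i j k)) ⊎ transpose i j k ≡ k
  transpose-cases {i} {j} di dj k with k ≟ᶠ i
  ... | yes refl = inj₁ (di , dj)
  ... | no _ with k ≟ᶠ j
  ...   | yes refl = inj₁ (dj , di)
  ...   | no _     = inj₂ refl

  transpose-i : ∀ (i j : Elt G) → transpose i j i ≡ j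
  transpose-i i j with i ≟ᶠ i
  ... | yes _ = refl
  ... | no ¬p = ⊥-elim (¬p refl)

  -- A vertex affected by the swap lands on a dominating vertex, which is comparable to everything.
  transpose-Comp : ∀ {i j} → Dominating i → Dominating j → ∀ {x y} →
    Comp x y → Comp (transpose i j x) (transpose i j y)
  transpose-Comp {i} {j} di dj {x} {y} c with transpose-cases di dj x | transpose-cases di dj y
  ... | inj₁ (_ , d) | _            = d _
  ... | inj₂ _       | inj₁ (_ , d) = Comp-sym (d _)
  ... | inj₂ ex      | inj₂ ey      = subst₂ Comp (sym ex) (sym ey) c

module _ (G₁ G₂ : FinGroup) where
  private
    module T₁ = Twins G₁
    module T₂ = Twins G₂

  to-injective : (f : Elt G₁ ↔ Elt G₂) → ∀ {x y} → Inverse.to f x ≡ Inverse.to f y → x ≡ y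
  to-injective f {x} {y} e = trans (sym (Inverse.strictlyInverseʳ f x)) (trans (cong (Inverse.from f) e) (Inverse.strictlyInverseʳ f y))

  -- Both ε and the image of ε are dominating, so composing with their transposition keeps an isomorphism.
  PAdj⇒CompIso : RelIso G₁ G₂ (PAdj G₁) (PAdj G₂) → CompIso G₁ G₂
  PAdj⇒CompIso (f , iso) = record
    { to        = λ x → transpose i T₂.ε (to x)
    ; from      = λ y → from (transpose T₂.ε i y)
    ; from-to   = λ x → trans (cong from (transpose-inverse T₂.ε i)) (strictlyInverseʳ x)
    ; to-from   = λ y → trans (cong (transpose i T₂.ε) (strictlyInverseˡ _)) (transpose-inverse i T₂.ε)
    ; to-comp   = λ c → transpose-Comp G₂ di dε (fwd c)
    ; from-comp = λ c → bwd (transpose-Comp G₂ dε di c)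
    ; to-ε      = transpose-i G₂ i T₂.ε
    ; from-ε    = trans (cong from (transpose-i G₂ T₂.ε i)) (strictlyInverseʳ T₁.ε)
    }
    where
    open Inverse f using (to; from; strictlyInverseˡ; strictlyInverseʳ)
    i = to T₁.ε
    fwd : ∀ {x y} → T₁.Comp x y → T₂.Comp (to x) (to y)
    fwd {x} {y} c with x ≟ᶠ y
    ... | yes refl = inj₁ T₂.⊑-refl
    ... | no x≢y   = proj₂ (PAdj⇒ G₂ (Equivalence.to (iso x y) (⇒PAdj G₁ (x≢y , c))))
    bwd : ∀ {x y} → T₂.Comp x y → T₁.Comp (from x) (from y)
    bwd {x} {y} c with x ≟ᶠ y
    ... | yes refl = inj₁ T₁.⊑-refl
    ... | no x≢y   = proj₂ (PAdj⇒ G₁ (Equivalence.from (iso (from x) (from y))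
      (subst₂ (PAdj G₂) (sym (strictlyInverseˡ x)) (sym (strictlyInverseˡ y)) (⇒PAdj G₂ (x≢y , c)))))
    dε : Dominating G₂ T₂.ε
    dε y = inj₁ (T₂.ε⊑ y)
    di : Dominating G₂ i
    di y = subst (T₂.Comp i) (strictlyInverseˡ y) (fwd (inj₁ (T₁.ε⊑ (from y))))

  PArc⇒PAdj : RelIso G₁ G₂ (PArc G₁) (PArc G₂) → RelIso G₁ G₂ (PAdj G₁) (PAdj G₂)
  PArc⇒PAdj (f , iso) = f , λ x y → mk⇔
    [ inj₁ ∘ Equivalence.to (iso x y) , inj₂ ∘ Equivalence.to (iso y x) ]
    [ inj₁ ∘ Equivalence.from (iso x y) , inj₂ ∘ Equivalence.from (iso y x) ]

  module _ (o₁ : ClassOrder G₁) (o₂ : ClassOrder G₂) where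
    private
      module R₁ = Rank G₁ o₁
      module R₂ = Rank G₂ o₂

    OArc⇒PAdj : RelIso G₁ G₂ (OArc G₁ o₁) (OArc G₂ o₂) → RelIso G₁ G₂ (PAdj G₁) (PAdj G₂)
    OArc⇒PAdj (f , iso) = f , λ x y → mk⇔
      (Prec⇒PAdj G₂ o₂ ∘ [ inj₁ ∘ Equivalence.to (iso y x) , inj₂ ∘ Equivalence.to (iso x y) ] ∘ PAdj⇒Prec G₁ o₁)
      (Prec⇒PAdj G₁ o₁ ∘ [ inj₁ ∘ Equivalence.from (iso y x) , inj₂ ∘ Equivalence.from (iso x y) ] ∘ PAdj⇒Prec G₂ o₂)

    PrecEq⇒OArc : RelIso G₁ G₂ (PrecEq G₁ o₁) (PrecEq G₂ o₂) → RelIso G₁ G₂ (OArc G₁ o₁) (OArc G₂ o₂)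
    PrecEq⇒OArc (f , iso) = f , λ x y → mk⇔
      (λ p → strict G₂ o₂ (λ e → R₁.Prec⇒≢ p (to-injective f e)) (Equivalence.to (iso y x) (inj₁ p)))
      (λ p → strict G₁ o₁ (λ { refl → R₂.Prec⇒≢ p refl }) (Equivalence.from (iso y x) (inj₁ p)))
      where
      strict : ∀ G o {x y} → x ≢ y → PrecEq G o x y → Prec G o x y
      strict G o x≢y (inj₁ p)   = p
      strict G o x≢y (inj₂ x≡y) = ⊥-elim (x≢y x≡y)

-- From quotient isomorphisms to bijections of the groups.

record ClassMap (G₁ G₂ : FinGroup) : Set where
  private
    module C₁ = Cyclic G₁
    module C₂ = Cyclic G₂
  field
    map   : Elt G₁ → Elt G₂
    map-⊑ : ∀ {x y} → x C₁.⊑ y → map x C₂.⊑ map y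
    gens≡ : ∀ x → C₁.gens x ≡ C₂.gens (map x)

module RankMatching {G₁ G₂ : FinGroup} (o₁ : ClassOrder G₁) (o₂ : ClassOrder G₂) (M : ClassMap G₁ G₂) where
  open ClassMap M
  private
    module C₁ = Cyclic G₁
    module C₂ = Cyclic G₂
    module R₁ = Rank G₁ o₁
    module R₂ = Rank G₂ o₂
    abstract
      matching : ∀ x → ∃ λ w → w C₂.~ map x × R₂.rank w ≡ R₁.rank x
      -- By `gens≡` the class of `map x` is large enough to contain this rank.
      matching x = R₂.rank-surjective (map x) (R₁.rank x) (subst (R₁.rank x <_) (gens≡ x) (R₁.rank<gens x))

  match : Elt G₁ → Elt G₂
  match x = proj₁ (matching x)

  match~ : ∀ x → match x C₂.~ map x
  match~ x = proj₁ (proj₂ (matching x))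

  match-rank : ∀ x → R₂.rank (match x) ≡ R₁.rank x
  match-rank x = proj₂ (proj₂ (matching x))

  match-⊑ : ∀ {x y} → x C₁.⊑ y → match x C₂.⊑ match y
  match-⊑ {x} {y} p = C₂.⊑-trans (proj₁ (match~ x)) (C₂.⊑-trans (map-⊑ p) (proj₂ (match~ y)))

  match-LT : ∀ {x y} → R₁.LT x y → R₂.LT (match x) (match y)
  match-LT {x} {y} l@((p , q) , _) = R₂.rank-mono⁻ (match-⊑ p , match-⊑ q)
    (subst₂ _<_ (sym (match-rank x)) (sym (match-rank y)) (R₁.rank-mono l))

-- The round trip keeps class and rank, which determine an element.
match-inverse : ∀ {G₁ G₂} o₁ o₂ (M : ClassMap G₁ G₂) (M⁻ : ClassMap G₂ G₁) →
  (∀ x → Cyclic._~_ G₁ (ClassMap.map M⁻ (ClassMap.map M x)) x) →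
  ∀ x → RankMatching.match o₂ o₁ M⁻ (RankMatching.match o₁ o₂ M x) ≡ x
match-inverse {G₁} {G₂} o₁ o₂ M M⁻ inv x = Rank.rank-injective G₁ o₁
  (~-trans (B.match~ (A.match x)) (~-trans (map-⊑ (proj₁ (A.match~ x)) , map-⊑ (proj₂ (A.match~ x))) (inv x)))
  (trans (B.match-rank (A.match x)) (A.match-rank x))
  where
  open Cyclic G₁
  open ClassMap M⁻
  module A = RankMatching o₁ o₂ M
  module B = RankMatching o₂ o₁ M⁻

module FromQuotient {G₁ G₂ : FinGroup} {o₁ : ClassOrder G₁} {o₂ : ClassOrder G₂} (Q : QuotIso G₁ G₂ o₁ o₂) where
  open QuotIso Q
  private
    module C₁ = Cyclic G₁
    module C₂ = Cyclic G₂
    module R₁ = Rank G₁ o₁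
    module R₂ = Rank G₂ o₂

    gens-τ : ∀ x → C₁.gens x ≡ C₂.gens (τ x)
    gens-τ x with card x
    ... | f , g , into , into⁻ , gf , fg = ≤-antisym
      (count-injection (C₁._~? x) (C₂._~? τ x) f
        (λ z e → C₂.~-sym (C₂.SameCls⇒~ (into z (cls₁ e))))
        (λ y z ey ez e → trans (sym (gf y (cls₁ ey))) (trans (cong g e) (gf z (cls₁ ez)))))
      (count-injection (C₂._~? τ x) (C₁._~? x) g
        (λ z e → C₁.~-sym (C₁.SameCls⇒~ (into⁻ z (cls₂ e))))
        (λ y z ey ez e → trans (sym (fg y (cls₂ ey))) (trans (cong f e) (fg z (cls₂ ez)))))
      where
      cls₁ : ∀ {z} → z C₁.~ x → SameCls G₁ x z
      cls₁ e = C₁.~⇒SameCls (C₁.~-sym e)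
      cls₂ : ∀ {z} → z C₂.~ τ x → SameCls G₂ (τ x) z
      cls₂ e = C₂.~⇒SameCls (C₂.~-sym e)

    τ⁻τ : ∀ x → τ⁻ (τ x) C₁.~ x
    τ⁻τ x = C₁.SameCls⇒~ (invˡ x)

    ττ⁻ : ∀ y → τ (τ⁻ y) C₂.~ y
    ττ⁻ y = C₂.SameCls⇒~ (invʳ y)

    M : ClassMap G₁ G₂
    M = record
      { map   = τ
      ; map-⊑ = λ {x} {y} p → QLe⇒⊑ G₂ o₂ (Equivalence.to (order x y) (⊑⇒QLe G₁ o₁ p))
      ; gens≡ = gens-τ
      }

    M⁻ : ClassMap G₂ G₁
    M⁻ = record
      { map   = τ⁻
      -- The field `order` speaks about images under `τ`, so `x` and `y` are first replaced by
      -- `τ (τ⁻ x)` and `τ (τ⁻ y)`.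
      ; map-⊑ = λ {x} {y} p → QLe⇒⊑ G₁ o₁ (Equivalence.from (order (τ⁻ x) (τ⁻ y))
                  (⊑⇒QLe G₂ o₂ (C₂.⊑-trans (proj₁ (ττ⁻ x)) (C₂.⊑-trans p (proj₂ (ττ⁻ y))))))
      ; gens≡ = λ y → trans (≤-antisym (C₂.gens-~ (C₂.~-sym (ττ⁻ y))) (C₂.gens-~ (ττ⁻ y))) (sym (gens-τ (τ⁻ y)))
      }

    module A = RankMatching o₁ o₂ M
    module B = RankMatching o₂ o₁ M⁻

    from-to : ∀ x → B.match (A.match x) ≡ x
    from-to = match-inverse o₁ o₂ M M⁻ τ⁻τ

    bijection : Elt G₁ ↔ Elt G₂
    bijection = mk↔ₛ′ A.match B.match (match-inverse o₂ o₁ M⁻ M ττ⁻) from-to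

    match-injective : ∀ {x y} → A.match x ≡ A.match y → x ≡ y
    match-injective = to-injective G₁ G₂ bijection

    match-⊑⁻ : ∀ {x y} → A.match x C₂.⊑ A.match y → x C₁.⊑ y
    match-⊑⁻ {x} {y} p = subst₂ C₁._⊑_ (from-to x) (from-to y) (B.match-⊑ p)

    match-LT⁻ : ∀ {x y} → R₂.LT (A.match x) (A.match y) → R₁.LT x y
    match-LT⁻ {x} {y} p = subst₂ R₁.LT (from-to x) (from-to y) (B.match-LT p)

    match-Prec : ∀ {x y} → Prec G₁ o₁ x y → Prec G₂ o₂ (A.match x) (A.match y)
    match-Prec = R₂.⇒Prec ∘
      [ inj₁ ∘ A.match-LT , (λ { (s , ¬s) → inj₂ (A.match-⊑ s , ¬s ∘ match-⊑⁻) }) ] ∘ R₁.Prec⇒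

    match-Prec⁻ : ∀ {x y} → Prec G₂ o₂ (A.match x) (A.match y) → Prec G₁ o₁ x y
    match-Prec⁻ = R₁.⇒Prec ∘
      [ inj₁ ∘ match-LT⁻ , (λ { (s , ¬s) → inj₂ (match-⊑⁻ s , ¬s ∘ A.match-⊑) }) ] ∘ R₂.Prec⇒

  PArc-iso : RelIso G₁ G₂ (PArc G₁) (PArc G₂)
  PArc-iso = bijection , λ x y → mk⇔
    (λ a → let x≢y , p = PArc⇒ G₁ a in ⇒PArc G₂ (x≢y ∘ match-injective , A.match-⊑ p))
    (λ a → let x≢y , p = PArc⇒ G₂ a in ⇒PArc G₁ (x≢y ∘ cong A.match , match-⊑⁻ p))

  OArc-iso : RelIso G₁ G₂ (OArc G₁ o₁) (OArc G₂ o₂)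
  OArc-iso = bijection , λ x y → mk⇔ match-Prec match-Prec⁻

  PrecEq-iso : RelIso G₁ G₂ (PrecEq G₁ o₁) (PrecEq G₂ o₂)
  PrecEq-iso = bijection , λ x y → mk⇔
    [ inj₁ ∘ match-Prec , inj₂ ∘ cong A.match ]
    [ inj₁ ∘ match-Prec⁻ , inj₂ ∘ match-injective ]

theorem2p14 : (G₁ G₂ : FinGroup) (o₁ : ClassOrder G₁) (o₂ : ClassOrder G₂) →
    (RelIso G₁ G₂ (PAdj G₁) (PAdj G₂) ⇔ RelIso G₁ G₂ (PArc G₁) (PArc G₂)) ×
    (RelIso G₁ G₂ (PArc G₁) (PArc G₂) ⇔ RelIso G₁ G₂ (OArc G₁ o₁) (OArc G₂ o₂)) ×
    (RelIso G₁ G₂ (OArc G₁ o₁) (OArc G₂ o₂) ⇔ RelIso G₁ G₂ (PrecEq G₁ o₁) (PrecEq G₂ o₂)) ×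
    (RelIso G₁ G₂ (PrecEq G₁ o₁) (PrecEq G₂ o₂) ⇔ QuotIso G₁ G₂ o₁ o₂)
theorem2p14 G₁ G₂ o₁ o₂ =
  mk⇔ (λ i → FromQuotient.PArc-iso (toQuotient i)) (PArc⇒PAdj G₁ G₂) ,
  mk⇔ (λ ii → FromQuotient.OArc-iso (toQuotient (PArc⇒PAdj G₁ G₂ ii))) (λ iii → FromQuotient.PArc-iso (toQuotient (OArc⇒PAdj G₁ G₂ o₁ o₂ iii))) ,
  mk⇔ (λ iii → FromQuotient.PrecEq-iso (toQuotient (OArc⇒PAdj G₁ G₂ o₁ o₂ iii))) (PrecEq⇒OArc G₁ G₂ o₁ o₂) ,
  mk⇔ (λ iv → toQuotient (OArc⇒PAdj G₁ G₂ o₁ o₂ (PrecEq⇒OArc G₁ G₂ o₁ o₂ iv))) FromQuotient.PrecEq-iso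
  where
  -- Hub of the equivalences: each graph or order isomorphism is reduced to power graph adjacency
  -- and passes through the quotient.
  toQuotient : RelIso G₁ G₂ (PAdj G₁) (PAdj G₂) → QuotIso G₁ G₂ o₁ o₂
  toQuotient i = CompIso⇒QuotIso o₁ o₂ (PAdj⇒CompIso G₁ G₂ i)
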